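{- Let $G=(V;E)$ be the random graph and let $\Gamma$ be a structure with domain $V$ all of whose relations are first-order definable in $G$. Then at least one of the following holds: (1) $\Gamma$ has a constant endomorphism; (2) $e_E$ is an endomorphism of $\Gamma$; (3) $e_N$ is an endomorphism of $\Gamma$; (4) $-$ is an automorphism of $\Gamma$; (5) ${\it sw}$ is an automorphism of $\Gamma$; (6) every endomorphism of $\Gamma$ lies in the smallest locally closed monoid of maps $V\to V$ containing $\mathrm{Aut}(G)$.
   Context: The random graph $G=(V;E)$ is the unique countably infinite graph such that for all finite disjoint $U,U'\subseteq V$ there is $v\in V\setminus(U\cup U')$ adjacent to all of $U$ and none of $U'$. A monoid of maps $V\to V$ is locally closed if it is closed in the product topology on $V^V$ ($V$ discrete). $e_E$ is a fixed injective map $V\to V$ whose image induces an infinite clique in $G$; $e_N$ is a fixed injective map $V\to V$ whose image induces an infinite independent set in $G$. $-$ is a fixed isomorphism from $G$ onto its complement graph. For a fixed vertex $0\in V$, ${\it sw}$ is a fixed isomorphism from $G$ onto the graph obtained from $G$ by exchanging edges and non-edges between $\{0\}$ and $V\setminus\{0\}$ (this graph is isomorphic to $G$). Different choices of these maps generate the same locally closed monoids together with $\mathrm{Aut}(G)$. An endomorphism of $\Gamma$ is a map $V\to V$ preserving all relations of $\Gamma$. -}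

module Defs where

open import Level using (0ℓ)
open import Data.Nat using (ℕ; zero; suc; _≟_)
open import Data.Fin using (Fin; zero; suc)
open import Data.List using (List)
open import Data.List.Relation.Unary.All using (All)
open import Data.List.Membership.Propositional using (_∈_; _∉_)
open import Data.Product using (Σ; ∃; _×_; _,_)
open import Data.Sum using (_⊎_)
open import Relation.Nullary using (¬_; yes; no)
open import Relation.Binary.PropositionalEquality using (_≡_; _≢_)
open import Function using (_∘_; id; const)
open import Function.Definitions using (Bijective; Injective)
open import Function.Bundles using (_⇔_)

V : Set
V = ℕ

Rel₂ : Set₁
Rel₂ = V → V → Set

record IsSimple (E : Rel₂) : Set where
  field
    irrefl : ∀ x → ¬ E x x
    sym    : ∀ x y → E x y → E y x

Disjoint : List V → List V → Set
Disjoint U U' = ∀ x → x ∈ U → x ∉ U'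

-- Extension property characterising the random graph (among countably
-- infinite graphs; V = ℕ is countably infinite).
ExtensionProperty : Rel₂ → Set
ExtensionProperty E =
  (U U' : List V) → Disjoint U U' →
  Σ V λ v → (v ∉ U) × (v ∉ U') × All (E v) U × All (λ u → ¬ E v u) U'

record IsRandomGraph (E : Rel₂) : Set where
  field
    simple    : IsSimple E
    extension : ExtensionProperty E

Compl : Rel₂ → Rel₂
Compl E x y = (x ≢ y) × ¬ E x y

Switch : Rel₂ → Rel₂
Switch E x y with x ≟ 0 | y ≟ 0
... | yes _ | yes _ = E x y
... | yes _ | no _  = ¬ E x y
... | no _  | yes _ = ¬ E x y
... | no _  | no _  = E x y

IsIso : Rel₂ → Rel₂ → (V → V) → Set
IsIso E E' f = Bijective _≡_ _≡_ f × (∀ x y → E x y ⇔ E' (f x) (f y))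

IsGraphAut : Rel₂ → (V → V) → Set
IsGraphAut E f = IsIso E E f

IsEE : Rel₂ → (V → V) → Set
IsEE E f = Injective _≡_ _≡_ f × (∀ x y → x ≢ y → E (f x) (f y))

IsEN : Rel₂ → (V → V) → Set
IsEN E f = Injective _≡_ _≡_ f × (∀ x y → ¬ E (f x) (f y))

data Formula : ℕ → Set where
  eq   : ∀ {n} → Fin n → Fin n → Formula n
  edge : ∀ {n} → Fin n → Fin n → Formula n
  neg  : ∀ {n} → Formula n → Formula n
  and  : ∀ {n} → Formula n → Formula n → Formula n
  or   : ∀ {n} → Formula n → Formula n → Formula n
  ex   : ∀ {n} → Formula (suc n) → Formula n
  all  : ∀ {n} → Formula (suc n) → Formula n

extend : ∀ {n} → V → (Fin n → V) → Fin (suc n) → V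
extend v ρ zero    = v
extend v ρ (suc i) = ρ i

Sat : Rel₂ → ∀ {n} → Formula n → (Fin n → V) → Set
Sat E (eq i j)   ρ = ρ i ≡ ρ j
Sat E (edge i j) ρ = E (ρ i) (ρ j)
Sat E (neg φ)    ρ = ¬ Sat E φ ρ
Sat E (and φ ψ)  ρ = Sat E φ ρ × Sat E ψ ρ
Sat E (or φ ψ)   ρ = Sat E φ ρ ⊎ Sat E ψ ρ
Sat E (ex φ)     ρ = Σ V λ v → Sat E φ (extend v ρ)
Sat E (all φ)    ρ = (v : V) → Sat E φ (extend v ρ)

record Structure : Set₁ where
  field
    Idx   : Set
    arity : Idx → ℕ
    rel   : (i : Idx) → (Fin (arity i) → V) → Set

open Structure public

FODefinable : Rel₂ → Structure → Set
FODefinable E Γ =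
  (i : Idx Γ) → Σ (Formula (arity Γ i)) λ φ →
    (t : Fin (arity Γ i) → V) → rel Γ i t ⇔ Sat E φ t

IsEndo : Structure → (V → V) → Set
IsEndo Γ f = (i : Idx Γ) (t : Fin (arity Γ i) → V) → rel Γ i t → rel Γ i (f ∘ t)

IsAuto : Structure → (V → V) → Set
IsAuto Γ f = Bijective _≡_ _≡_ f ×
  ((i : Idx Γ) (t : Fin (arity Γ i) → V) → rel Γ i t ⇔ rel Γ i (f ∘ t))

IsMonoidOfMaps : ((V → V) → Set) → Set
IsMonoidOfMaps M = M id × (∀ f g → M f → M g → M (f ∘ g))

-- Closed in the product (pointwise convergence) topology on V^V.
IsLocallyClosed : ((V → V) → Set) → Set
IsLocallyClosed M =
  ∀ f → ((xs : List V) → Σ (V → V) λ g → M g × All (λ x → g x ≡ f x) xs) → M f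

InGeneratedLCMonoid : ((V → V) → Set) → (V → V) → Set₁
InGeneratedLCMonoid S f =
  (M : (V → V) → Set) → IsMonoidOfMaps M → IsLocallyClosed M →
  (∀ g → S g → M g) → M f

{-# OPTIONS --safe #-}
module Submission where

-- Let M be the closed monoid of endomorphisms of Γ; it contains Aut(G). If some map in M identifies two
-- adjacent and some map in M two non-adjacent vertices, then finite sets can be contracted to points and
-- M contains the constants. If only one kind of pairs is ever identified, then the other kind is preserved
-- by M, and contracting a blow-up of a finite graph turns all its pairs into pairs of the preserved kind.
--
-- Otherwise all maps in M are injective. Let g ∈ M and let c₁, c₂ be distinct vertices. By the Hales–Jewett
-- theorem (through the partite construction) and Ramsey's theorem, every finite graph whose vertices are
-- labelled with types over c₁, c₂ has a copy on which the action of g on a pair depends only on the two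
-- types, their order, and the adjacency. On the pairs of two fixed types g then acts by one of the four
-- functions Bool → Bool. For equal types the two constant functions give e_E and e_N and negation gives −;
-- knowing that the identity acts there, for distinct types, and for the pairs with a constant, the action
-- is confined to the star of one vertex, where the constant functions again give e_E and e_N (by iteration
-- over all stars) and negation gives sw. If none of these maps is in M, then g can change at most the
-- adjacency of c₁ and c₂ and nothing else. If it does, iterating over all pairs of a finite set gives e_E
-- or e_N once more; so g is an embedding of G, which by homogeneity is a limit of automorphisms.

open import Defs hiding (eq; edge; neg; and; or; ex; all)
open import Level using (0ℓ)
open import Axiom.ExcludedMiddle using (ExcludedMiddle)
open import Data.Bool using (Bool; true; false; if_then_else_; not)
import Data.Bool as Bool
open import Data.Bool.Properties using (¬-not; not-involutive)
open import Data.Empty using (⊥)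
open import Data.Fin using (Fin; zero; suc; toℕ)
import Data.Fin.Properties as Fin
open import Data.List using (List; []; _∷_; length; filter; upTo; allFin; cartesianProduct; cartesianProductWith)
  renaming (map to mapᴸ; _++_ to _++ᴸ_)
import Data.List as List
open import Data.List.Properties using (length-upTo; length-map)
open import Data.List.Membership.Propositional using (_∈_; _∉_)
open import Data.List.Membership.Propositional.Properties
  using ( ∈-filter⁺; ∈-filter⁻; ∈-map⁺; ∈-map⁻; ∈-upTo⁺; ∈-upTo⁻; ∈-++⁺ˡ; ∈-++⁺ʳ; ∈-lookup; ∈-allFin
        ; ∈-cartesianProduct⁺; ∈-cartesianProductWith⁺ )
open import Data.List.Relation.Unary.All using (All; []; _∷_)
import Data.List.Relation.Unary.All as All
import Data.List.Relation.Unary.All.Properties as All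
open import Data.List.Relation.Unary.AllPairs using (AllPairs; []; _∷_)
import Data.List.Relation.Unary.AllPairs.Properties as AllPairs
open import Data.List.Relation.Unary.Any using (here; there; index)
open import Data.List.Relation.Unary.Any.Properties using (lookup-index)
open import Data.List.Relation.Binary.Sublist.Propositional using (_⊆_; []; _∷ʳ_; _∷_; ⊆-trans; minimum)
open import Data.List.Relation.Binary.Sublist.Propositional.Properties using (All-resp-⊆; filter-⊆; map⁺)
open import Data.Maybe using (Maybe; just; nothing)
import Data.Maybe as Maybe
open import Data.Nat using (ℕ; zero; suc; _+_; _*_; _≤_; _<_; _⊔_; z≤n; s≤s; z<s; s<s; _≤′_; ≤′-refl; ≤′-step)
import Data.Nat.Properties as ℕ
open import Data.Product using (Σ; ∃; ∃₂; _×_; _,_; proj₁; proj₂; swap)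
open import Data.Sum using (_⊎_; inj₁; inj₂; [_,_])
open import Data.Vec using (Vec; []; _∷_; _++_; map; lookup; fromList)
open import Data.Vec.Properties using (map-∘; map-cong; map-++; map-id; lookup-map; ∷-injectiveˡ; ∷-injectiveʳ)
open import Function using (_∘_; id; const)
open import Function.Bundles using (_⇔_; mk⇔; Equivalence)
import Function.Construct.Composition as Composition
open import Function.Construct.Composition using (_⇔-∘_)
import Function.Construct.Identity as Identity
open import Function.Construct.Identity using (⇔-id)
open import Function.Definitions using (Injective; Bijective)
open import Relation.Binary.Definitions using (tri<; tri≈; tri>)
open import Relation.Binary.PropositionalEquality using (_≡_; _≢_; refl; sym; trans; cong; cong₂; subst)
open import Relation.Nullary using (¬_; Dec; yes; no; does; contradiction)
open import Relation.Nullary.Decidable using (dec-true; dec-false; decidable-stable)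
open Equivalence using (to; from)

-- Finite types and the pigeonhole principle

record Finite (A : Set) : Set where
  field
    elements : List A
    complete : ∀ a → a ∈ elements

open Finite

finite-Bool : Finite Bool
finite-Bool = record
  { elements = true ∷ false ∷ []
  ; complete = λ { true → here refl ; false → there (here refl) } }

finite-Fin : ∀ n → Finite (Fin n)
finite-Fin n = record { elements = allFin n ; complete = ∈-allFin }

finite-× : ∀ {A B} → Finite A → Finite B → Finite (A × B)
finite-× FA FB = record
  { elements = cartesianProduct (elements FA) (elements FB)
  ; complete = λ (a , b) → ∈-cartesianProduct⁺ (complete FA a) (complete FB b) }

finite-Vec : ∀ {A} → Finite A → ∀ n → Finite (Vec A n)
finite-Vec FA zero = record { elements = [] ∷ [] ; complete = λ { [] → here refl } }
finite-Vec FA (suc n) = record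
  { elements = cartesianProductWith _∷_ (elements FA) (elements (finite-Vec FA n))
  ; complete = λ { (a ∷ as) →
      ∈-cartesianProductWith⁺ _∷_ (complete FA a) (complete (finite-Vec FA n) as) } }

finite-bound : ∀ {A} (FA : Finite A) {r} (f : Fin r → A) → Injective _≡_ _≡_ f → r ≤ length (elements FA)
finite-bound FA {r} f inj with r ℕ.≤? length (elements FA)
... | yes r≤ = r≤
... | no r≰ with Fin.pigeonhole (ℕ.≰⇒> r≰) (λ i → index (complete FA (f i)))
...   | i , j , i<j , same = contradiction
          (inj (trans (lookup-index (complete FA (f i)))
                 (trans (cong (List.lookup (elements FA)) same)
                        (sym (lookup-index (complete FA (f j)))))))
          (Fin.<⇒≢ i<j)

-- A function on a finite type is coded by the vector of its values along an enumeration; such codes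
-- serve as colours in the Hales-Jewett induction.
map-fromList-injective : ∀ {A K : Set} {f g : A → K} (xs : List A) →
  map f (fromList xs) ≡ map g (fromList xs) → ∀ {x} → x ∈ xs → f x ≡ g x
map-fromList-injective (x ∷ xs) eq (here refl) = ∷-injectiveˡ eq
map-fromList-injective (x ∷ xs) eq (there x∈)  = map-fromList-injective xs (∷-injectiveʳ eq) x∈

-- Hales–Jewett, by colour focusing

Word : ℕ → ℕ → Set
Word k N = Vec (Fin k) N

-- A word with a variable: `nothing` marks the moving positions. `Moving` excludes degenerate lines
-- consisting of one point.
Line : ℕ → ℕ → Set
Line k N = Vec (Maybe (Fin k)) N

Moving : ∀ {k N} → Line k N → Set
Moving {N = N} L = Σ (Fin N) λ d → lookup L d ≡ nothing

at : ∀ {k N} → Line k N → Fin k → Word k N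
at L a = map (Maybe.fromMaybe a) L

Mono : ∀ {k N} {K : Set} → (Word (suc k) N → K) → Line (suc k) N → Set
Mono C L = Moving L × (∀ a → C (at L a) ≡ C (at L zero))

-- The letter zero plays the role of the new letter in the induction on the alphabet.
record Focused {k N} {K : Set} (C : Word (suc k) N → K) (r : ℕ) : Set where
  field
    focus     : Word (suc k) N
    line      : Fin r → Line (suc k) N
    colour    : Fin r → K
    moving    : ∀ q → Moving (line q)
    focused   : ∀ q → at (line q) zero ≡ focus
    coloured  : ∀ q a → C (at (line q) (suc a)) ≡ colour q
    distinct  : Injective _≡_ _≡_ colour

at-++ : ∀ {k M N} (L : Line k M) (l : Line k N) a → at (L ++ l) a ≡ at L a ++ at l a
at-++ L l a = map-++ _ L l

at-just : ∀ {k N} (w : Word k N) a → at (map just w) a ≡ w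
at-just w a = trans (sym (map-∘ _ just w)) (map-id w)

at-lift : ∀ {k N} (L : Line k N) a → at (map (Maybe.map suc) L) (suc a) ≡ map suc (at L a)
at-lift L a = trans (sym (map-∘ _ _ L)) (trans (map-cong lift-letter L) (map-∘ suc _ L))
  where
  lift-letter : ∀ x → Maybe.fromMaybe (suc a) (Maybe.map suc x) ≡ suc (Maybe.fromMaybe a x)
  lift-letter (just _) = refl
  lift-letter nothing  = refl

moving-++ˡ : ∀ {k M N} (L : Line k M) (l : Line k N) → Moving L → Moving (L ++ l)
moving-++ˡ (x ∷ L) l (zero , eq)  = zero , eq
moving-++ˡ (x ∷ L) l (suc d , eq) with moving-++ˡ L l (d , eq)
... | d₁ , eq₁ = suc d₁ , eq₁

moving-++ʳ : ∀ {k M N} (L : Line k M) {l : Line k N} → Moving l → Moving (L ++ l)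
moving-++ʳ []      m = m
moving-++ʳ (x ∷ L) m with moving-++ʳ L m
... | d , eq = suc d , eq

moving-lift : ∀ {k N} {L : Line k N} → Moving L → Moving (map (Maybe.map suc) L)
moving-lift {L = L} (d , eq) = d , trans (lookup-map d _ L) (cong (Maybe.map suc) eq)

module _ (em : ExcludedMiddle 0ℓ) where
  open Focused

  -- Induction on the alphabet. For the step, ever larger families of focused lines are built, until
  -- their distinct colours outnumber `K`.
  hales-jewett : ∀ k {K} → Finite K → ∃ λ N → (C : Word (suc k) N → K) → Σ (Line (suc k) N) (Mono C)
  hales-jewett zero    FK = 1 , λ C → nothing ∷ [] , (zero , refl) , λ { zero → refl }
  hales-jewett (suc k) {K} FK = N , go
    where
    focusing : ∀ r → ∃ λ N → (C : Word (suc (suc k)) N → K) → Σ (Line (suc (suc k)) N) (Mono C) ⊎ Focused C r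
    focusing zero = 0 , λ C → inj₂ (record
      { focus = [] ; line = λ () ; colour = λ () ; moving = λ () ; focused = λ ()
      ; coloured = λ () ; distinct = λ { {()} } })
    focusing (suc r) = N₂ + N₁ , step
      where
      N₁ = proj₁ (focusing r)
      words = finite-Vec (finite-Fin (suc (suc k))) N₁
      -- A word on the first block is coloured by the whole function it induces on the second block.
      -- As `N₁` is fixed beforehand, these functions form a finite set of colours.
      HJ = hales-jewett k (finite-Vec FK (length (elements words)))
      N₂ = proj₁ HJ
      step : (C : Word (suc (suc k)) (N₂ + N₁) → K) → Σ (Line (suc (suc k)) (N₂ + N₁)) (Mono C) ⊎ Focused C (suc r)
      step C with proj₂ HJ (λ v → map (λ w → C (map suc v ++ w)) (fromList (elements words)))
      ... | L , movL , monoL = result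
        where
        L⁺ = map (Maybe.map suc) L
        -- The letter `suc zero` stands for any letter other than zero: by `L⁺-mono` all of them
        -- induce the same colouring of the second block.
        D : Word (suc (suc k)) N₁ → K
        D w = C (at L⁺ (suc zero) ++ w)
        L⁺-mono : ∀ a w → C (at L⁺ (suc a) ++ w) ≡ D w
        L⁺-mono a w rewrite at-lift L a | at-lift L zero =
          map-fromList-injective (elements words) (monoL a) (complete words w)
        result : Σ (Line (suc (suc k)) (N₂ + N₁)) (Mono C) ⊎ Focused C (suc r)
        mono-D : Σ (Line (suc (suc k)) N₁) (Mono D) → Σ (Line (suc (suc k)) (N₂ + N₁)) (Mono C)
        mono-D (l , mov , mono) = map just w ++ l , moving-++ʳ (map just w) mov , λ a →
          trans (shape a) (trans (mono a) (sym (shape zero)))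
          where
          w = at L⁺ (suc zero)
          shape : ∀ a → C (at (map just w ++ l) a) ≡ D (at l a)
          shape a = cong C (trans (at-++ (map just w) l a) (cong (_++ at l a) (at-just w a)))
        result with proj₂ (focusing r) D
        ... | inj₁ m = inj₁ (mono-D m)
        ... | inj₂ F with em {Σ (Fin r) λ q → colour F q ≡ D (focus F)}
        -- If the focus has the colour of some line, the letter zero completes that line. Otherwise
        -- the colour of the focus is new and yields one more line.
        ...   | yes (q , eq) = inj₁ (mono-D (line F q , moving F q ,
                  λ { zero → refl ; (suc a) → trans (coloured F q a) (trans eq (cong D (sym (focused F q)))) }))
        ...   | no fresh = inj₂ (record
                  { focus = at L⁺ zero ++ focus F ; line = line₁ ; colour = colour₁ ; moving = moving₁
                  ; focused = focused₁ ; coloured = coloured₁ ; distinct = distinct₁ })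
          where
          line₁ : Fin (suc r) → Line (suc (suc k)) (N₂ + N₁)
          -- The new line moves only in the first block, with the second fixed at the old focus; the
          -- old lines now move in both blocks, so all lines still meet at the letter zero.
          line₁ zero    = L⁺ ++ map just (focus F)
          line₁ (suc q) = L⁺ ++ line F q
          colour₁ : Fin (suc r) → K
          colour₁ zero    = D (focus F)
          colour₁ (suc q) = colour F q
          moving₁ : ∀ q → Moving (line₁ q)
          moving₁ zero    = moving-++ˡ L⁺ _ (moving-lift {L = L} movL)
          moving₁ (suc q) = moving-++ˡ L⁺ _ (moving-lift {L = L} movL)
          focused₁ : ∀ q → at (line₁ q) zero ≡ at L⁺ zero ++ focus F
          focused₁ zero    = trans (at-++ L⁺ _ zero) (cong (at L⁺ zero ++_) (at-just (focus F) zero))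
          focused₁ (suc q) = trans (at-++ L⁺ _ zero) (cong (at L⁺ zero ++_) (focused F q))
          coloured₁ : ∀ q a → C (at (line₁ q) (suc a)) ≡ colour₁ q
          coloured₁ zero a =
            trans (cong C (trans (at-++ L⁺ _ (suc a)) (cong (at L⁺ (suc a) ++_) (at-just (focus F) (suc a)))))
                  (L⁺-mono a (focus F))
          coloured₁ (suc q) a = trans (cong C (at-++ L⁺ _ (suc a)))
            (trans (L⁺-mono a _) (coloured F q a))
          distinct₁ : Injective _≡_ _≡_ colour₁
          distinct₁ {zero}  {zero}   eq = refl
          distinct₁ {zero}  {suc q}  eq = contradiction (q , sym eq) fresh
          distinct₁ {suc q} {zero}   eq = contradiction (q , eq) fresh
          distinct₁ {suc q} {suc q₁} eq = cong suc (distinct F eq)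

    bound = suc (length (elements FK))
    N = proj₁ (focusing bound)
    go : (C : Word (suc (suc k)) N → K) → Σ (Line (suc (suc k)) N) (Mono C)
    go C with proj₂ (focusing bound) C
    ... | inj₁ m = m
    ... | inj₂ F = contradiction (finite-bound FK (colour F) (distinct F)) ℕ.1+n≰n

-- Ramsey's theorem for pairs

AllPairs-resp-⊆ : ∀ {A : Set} {R : A → A → Set} {xs ys} → xs ⊆ ys → AllPairs R ys → AllPairs R xs
AllPairs-resp-⊆ []         []       = []
AllPairs-resp-⊆ (y ∷ʳ τ)   (_ ∷ ps) = AllPairs-resp-⊆ τ ps
AllPairs-resp-⊆ (refl ∷ τ) (p ∷ ps) = All-resp-⊆ τ p ∷ AllPairs-resp-⊆ τ ps

module _ (em : ExcludedMiddle 0ℓ) where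

  length-filter-split : ∀ {A : Set} (P : A → Set) xs →
    length xs ≡ length (filter (λ x → em {P x}) xs) + length (filter (λ x → em {¬ P x}) xs)
  length-filter-split P []       = refl
  length-filter-split P (x ∷ xs) with em {P x} | em {¬ P x}
  ... | yes p | yes ¬p = contradiction p ¬p
  ... | yes p | no _   = cong suc (length-filter-split P xs)
  ... | no _  | yes _  = trans (cong suc (length-filter-split P xs)) (sym (ℕ.+-suc _ _))
  ... | no ¬p | no ¬¬p = contradiction ¬p ¬¬p

  pigeonhole-⊆ : ∀ {A K : Set} (f : A → K) ks n xs → All (λ x → f x ∈ ks) xs →
    length ks * n < length xs → ∃₂ λ k ys → ys ⊆ xs × n < length ys × All (λ y → f y ≡ k) ys
  pigeonhole-⊆ f [] n (x ∷ xs) (() ∷ _) _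
  pigeonhole-⊆ f (k ∷ ks) n xs inks long
    with n ℕ.<? length (filter (λ x → em {f x ≡ k}) xs)
  ... | yes n< = k , _ , filter-⊆ _ xs , n< , All.all-filter _ xs
  ... | no n≮ with pigeonhole-⊆ f ks n others rest long′
    where
    others = filter (λ x → em {f x ≢ k}) xs
    rest : All (λ x → f x ∈ ks) others
    rest = All.zipWith (λ { (here eq , ne) → contradiction eq ne ; (there x∈ , _) → x∈ })
             (All-resp-⊆ (filter-⊆ _ xs) inks , All.all-filter (λ x → em {f x ≢ k}) xs)
    long′ : length ks * n < length others
    long′ = ℕ.+-cancelˡ-< n _ _ (ℕ.<-≤-trans long
      (ℕ.≤-trans (ℕ.≤-reflexive (length-filter-split (λ x → f x ≡ k) xs)) (ℕ.+-monoˡ-≤ _ (ℕ.≮⇒≥ n≮))))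
  ...   | k₁ , ys , ys⊆ , n< , mono = k₁ , ys , ⊆-trans ys⊆ (filter-⊆ _ xs) , n< , mono

  module _ {K : Set} (FK : Finite K) where

    private
      pigeonhole : ∀ {B : Set} (f : B → K) n xs → length (elements FK) * n < length xs →
        ∃₂ λ k ys → ys ⊆ xs × n < length ys × All (λ y → f y ≡ k) ys
      pigeonhole f n xs = pigeonhole-⊆ f (elements FK) n xs (All.universal (λ x → complete FK (f x)) xs)

    end-homogeneous-bound : ℕ → ℕ
    end-homogeneous-bound zero    = 0
    -- One for the head, and one because the pigeonhole principle needs strictly more elements than
    -- the product.
    end-homogeneous-bound (suc m) = suc (suc (length (elements FK) * end-homogeneous-bound m))

    -- Each selected element carries the colour of its pairs with all later ones: before the
    -- recursion continues, the tail is thinned to a single colour with the head.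
    end-homogeneous : ∀ {A : Set} (c : A → A → K) m xs → end-homogeneous-bound m ≤ length xs →
      Σ (List (A × K)) λ zs → mapᴸ proj₁ zs ⊆ xs × m ≤ length zs × AllPairs (λ (a , k) (b , _) → c a b ≡ k) zs
    end-homogeneous c zero    xs       _          = [] , minimum xs , z≤n , []
    end-homogeneous c (suc m) (x ∷ xs) (s≤s long) with pigeonhole (c x) _ xs long
    ... | k , ys , ys⊆ , n< , mono with end-homogeneous c m ys (ℕ.<⇒≤ n<)
    ... | zs , zs⊆ , m≤ , hom =
      (x , k) ∷ zs , refl ∷ ⊆-trans zs⊆ ys⊆ , s≤s m≤ , All.map⁻ (All-resp-⊆ zs⊆ mono) ∷ hom

    ramsey-bound : ℕ → ℕ
    ramsey-bound m = end-homogeneous-bound (suc (length (elements FK) * m))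

    opaque
      -- A last pigeonhole argument, on the colours carried by the elements of an end-homogeneous
      -- list.
      ramsey : ∀ {A : Set} (c : A → A → K) m xs → ramsey-bound m ≤ length xs → ∃₂ λ k ys →
        ys ⊆ xs × m ≤ length ys × AllPairs (λ a b → c a b ≡ k) ys
      ramsey c m xs long with end-homogeneous c _ xs long
      ... | zs , zs⊆ , m< , hom with pigeonhole proj₂ m zs m<
      ... | k , ys , ys⊆ , m<ys , mono =
        k , mapᴸ proj₁ ys , ⊆-trans (map⁺ proj₁ ys⊆) zs⊆
        , ℕ.≤-trans (ℕ.<⇒≤ m<ys) (ℕ.≤-reflexive (sym (length-map proj₁ ys)))
        , monochromatic (AllPairs-resp-⊆ ys⊆ hom) mono
        where
        monochromatic : ∀ {ys} → AllPairs (λ (a , k) (b , _) → c a b ≡ k) ys → All (λ y → proj₂ y ≡ k) ys →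
          AllPairs (λ a b → c a b ≡ k) (mapᴸ proj₁ ys)
        monochromatic []       []           = []
        monochromatic (p ∷ ps) (refl ∷ eqs) = All.map⁺ p ∷ monochromatic ps eqs

-- Homogeneity of the random graph

module Adjacency (em : ExcludedMiddle 0ℓ) (E : Rel₂) where

  adj : V → V → Bool
  adj x y = does (em {E x y})

  E⇒adj : ∀ {x y} → E x y → adj x y ≡ true
  E⇒adj {x} {y} e with em {E x y}
  ... | yes _ = refl
  ... | no ¬e = contradiction e ¬e

  adj⇒E : ∀ {x y} → adj x y ≡ true → E x y
  adj⇒E {x} {y} eq with em {E x y}
  ... | yes e = e

  ¬E⇒adj : ∀ {x y} → ¬ E x y → adj x y ≡ false
  ¬E⇒adj {x} {y} ¬e with em {E x y}
  ... | yes e = contradiction e ¬e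
  ... | no _  = refl

module RandomGraph (em : ExcludedMiddle 0ℓ) {E : Rel₂} (random : IsRandomGraph E) where
  open IsRandomGraph random
  open IsSimple simple using (irrefl)
  open Adjacency em E public

  adj-sym : ∀ x y → adj x y ≡ adj y x
  adj-sym x y with em {E y x}
  ... | yes e = E⇒adj (IsSimple.sym simple y x e)
  ... | no ¬e = ¬E⇒adj (λ e → ¬e (IsSimple.sym simple x y e))

  adj-irrefl : ∀ x → adj x x ≡ false
  adj-irrefl x = ¬E⇒adj (irrefl x)

  adj-preserved : (f : V → V) → (∀ {x y} → x ≢ y → adj (f x) (f y) ≡ adj x y) → ∀ x y → adj (f x) (f y) ≡ adj x y
  adj-preserved f preserves x y with x ℕ.≟ y
  ... | yes refl = trans (adj-irrefl (f x)) (sym (adj-irrefl x))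
  ... | no x≢y   = preserves x≢y

  id-aut : IsGraphAut E id
  id-aut = Identity.bijective _≡_ , λ _ _ → ⇔-id _

  realize : (c : V → Bool) (xs : List V) → Σ V λ v → v ∉ xs × (∀ {x} → x ∈ xs → adj v x ≡ c x)
  realize c xs with extension (chosen true) (chosen false) disjoint
    where
    chosen : Bool → List V
    chosen b = filter (λ x → c x Bool.≟ b) xs
    disjoint : Disjoint (chosen true) (chosen false)
    coloured : ∀ {b x} → x ∈ chosen b → c x ≡ b
    coloured {b} x∈ = proj₂ (∈-filter⁻ (λ x → c x Bool.≟ b) {xs = xs} x∈)
    disjoint x x∈ x∈′ with trans (sym (coloured x∈)) (coloured x∈′)
    ... | ()
  ... | v , v∉ , v∉′ , adjacent , nonadjacent = v , fresh , matches
    where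
    fresh : v ∉ xs
    fresh v∈ with c v in eq
    ... | true  = v∉ (∈-filter⁺ _ v∈ eq)
    ... | false = v∉′ (∈-filter⁺ _ v∈ eq)
    matches : ∀ {x} → x ∈ xs → adj v x ≡ c x
    matches {x} x∈ with c x in eq
    ... | true  = E⇒adj (All.lookup adjacent (∈-filter⁺ _ x∈ eq))
    ... | false = ¬E⇒adj (All.lookup nonadjacent (∈-filter⁺ _ x∈ eq))

  Compatible : V × V → V × V → Set
  Compatible (x , y) (x′ , y′) = (x ≡ x′ → y ≡ y′) × (y ≡ y′ → x ≡ x′) × adj x x′ ≡ adj y y′

  PartialIso : List (V × V) → Set
  PartialIso L = ∀ {p q} → p ∈ L → q ∈ L → Compatible p q

  compatible-sym : ∀ {p q} → Compatible p q → Compatible q p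
  compatible-sym {x , y} {x′ , y′} (f , g , eq) =
    sym ∘ f ∘ sym , sym ∘ g ∘ sym , trans (adj-sym x′ x) (trans eq (adj-sym y y′))

  partial-iso-∷ : ∀ {x y L} → PartialIso L → (∀ {p} → p ∈ L → Compatible (x , y) p) → PartialIso ((x , y) ∷ L)
  partial-iso-∷ {x} {y} iso new (here refl) (here refl) =
    (λ _ → refl) , (λ _ → refl) , trans (adj-irrefl x) (sym (adj-irrefl y))
  partial-iso-∷ iso new (here refl) (there q∈)  = new q∈
  partial-iso-∷ iso new (there p∈)  (here refl) = compatible-sym (new p∈)
  partial-iso-∷ iso new (there p∈)  (there q∈)  = iso p∈ q∈

  partial-iso-swap : ∀ {L} → PartialIso L → PartialIso (mapᴸ swap L)
  partial-iso-swap {L} iso p∈ q∈ with ∈-map⁻ swap p∈ | ∈-map⁻ swap q∈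
  ... | _ , p∈′ , refl | _ , q∈′ , refl with iso p∈′ q∈′
  ...   | f , g , eq = g , f , sym eq

  extend-domain : ∀ {L} → PartialIso L → ∀ x → Σ V λ y → PartialIso ((x , y) ∷ L)
  extend-domain {L} iso x with em {Σ V λ y → (x , y) ∈ L}
  ... | yes (y , xy∈) = y , partial-iso-∷ iso (iso xy∈)
  ... | no x∉ with realize c (mapᴸ proj₂ L)
    where
    c : V → Bool
    -- The prescription has to be a function of the range vertex alone. Since `L` is a partial
    -- isomorphism, `y` has at most one preimage, so this is consistent.
    c y = does (em {Σ V λ x′ → (x′ , y) ∈ L × adj x x′ ≡ true})
  ...   | y , y∉ , matches = y , partial-iso-∷ iso λ p∈ →
            (λ { refl → contradiction (_ , p∈) x∉ }) , (λ { refl → contradiction (∈-map⁺ proj₂ p∈) y∉ })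
            , trans (sym (colour p∈)) (sym (matches (∈-map⁺ proj₂ p∈)))
    where
    colour : ∀ {x′ y′} → (x′ , y′) ∈ L → does (em {Σ V λ x′ → (x′ , y′) ∈ L × adj x x′ ≡ true}) ≡ adj x x′
    colour {x′} {y′} p∈ with em {Σ V λ x′ → (x′ , y′) ∈ L × adj x x′ ≡ true}
    ... | yes (x″ , q∈ , eq) = trans (sym eq) (cong (adj x) (proj₁ (proj₂ (iso q∈ p∈)) refl))
    ... | no ¬eq with adj x x′ in eq
    ...   | true  = contradiction (x′ , p∈ , eq) ¬eq
    ...   | false = refl

  extend-range : ∀ {L} → PartialIso L → ∀ y → Σ V λ x → PartialIso ((x , y) ∷ L)
  extend-range {L} iso y with extend-domain (partial-iso-swap iso) y
  ... | x , iso′ = x , partial-iso-∷ iso λ p∈ →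
    let f , g , eq = iso′ (here refl) (there (∈-map⁺ swap p∈)) in g , f , sym eq

  module BackAndForth {L₀ : List (V × V)} (iso₀ : PartialIso L₀) where

    -- Stage `suc k` adds a pair with first component `k` and one with second component `k`. As `V`
    -- is ℕ, the vertices enumerate themselves, and the union of the stages is the graph of an
    -- automorphism.
    stage : ℕ → Σ (List (V × V)) PartialIso
    forth : ∀ k → Σ V λ y → PartialIso ((k , y) ∷ proj₁ (stage k))
    back  : ∀ k → Σ V λ x → PartialIso ((x , k) ∷ (k , proj₁ (forth k)) ∷ proj₁ (stage k))

    stage zero    = L₀ , iso₀
    stage (suc k) = _ , proj₂ (back k)

    forth k = extend-domain (proj₂ (stage k)) k
    back  k = extend-range (proj₂ (forth k)) k

    stage-mono : ∀ {i j p} → i ≤′ j → p ∈ proj₁ (stage i) → p ∈ proj₁ (stage j)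
    stage-mono ≤′-refl       p∈ = p∈
    stage-mono (≤′-step i≤j) p∈ = there (there (stage-mono i≤j p∈))

    Limit : V × V → Set
    Limit p = ∃ λ k → p ∈ proj₁ (stage k)

    limit-compatible : ∀ {p q} → Limit p → Limit q → Compatible p q
    limit-compatible (i , p∈) (j , q∈) = proj₂ (stage (i ⊔ j))
      (stage-mono (ℕ.≤⇒≤′ (ℕ.m≤m⊔n i j)) p∈) (stage-mono (ℕ.≤⇒≤′ (ℕ.m≤n⊔m i j)) q∈)

    α : V → V
    α x = proj₁ (forth x)

    α-limit : ∀ x → Limit (x , α x)
    α-limit x = suc x , there (here refl)

    α-aut : IsGraphAut E α
    α-aut = (injective , surjective) , λ x y →
      let eq = proj₂ (proj₂ (limit-compatible (α-limit x) (α-limit y))) in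
      mk⇔ (λ e → adj⇒E (trans (sym eq) (E⇒adj e))) (λ e → adj⇒E (trans eq (E⇒adj e)))
      where
      injective : ∀ {x y} → α x ≡ α y → x ≡ y
      injective {x} {y} = proj₁ (proj₂ (limit-compatible (α-limit x) (α-limit y)))
      surjective : ∀ y → ∃ λ x → ∀ {z} → z ≡ x → α z ≡ y
      -- The limit pairs this vertex both with its value under `α` and with `y`, and it is
      -- single-valued.
      surjective y = proj₁ (back y) , λ { refl →
        proj₁ (limit-compatible (α-limit (proj₁ (back y))) (suc y , here refl)) refl }

  opaque
    homogeneity : ∀ N (p q : ℕ → V) →
      (∀ {i j} → i < N → j < N → Compatible (p i , q i) (p j , q j)) →
      Σ (V → V) λ α → IsGraphAut E α × (∀ {i} → i < N → α (p i) ≡ q i)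
    homogeneity N p q compatible = α , α-aut , λ i<N →
      proj₁ (limit-compatible (α-limit _) (0 , ∈-map⁺ pair (∈-upTo⁺ i<N))) refl
      where
      pair : ℕ → V × V
      pair i = p i , q i
      iso₀ : PartialIso (mapᴸ pair (upTo N))
      iso₀ p∈ q∈ with ∈-map⁻ pair p∈ | ∈-map⁻ pair q∈
      ... | i , i∈ , refl | j , j∈ , refl = compatible (∈-upTo⁻ i∈) (∈-upTo⁻ j∈)
      open BackAndForth iso₀

-- Partite homogenization

-- The adjacencies of a vertex to the two constants.
Type : Set
Type = Bool × Bool

finite-Type : Finite Type
finite-Type = finite-× finite-Bool finite-Bool

Square : Set → Set
Square A = A × A

finite-Square : ∀ {A} → Finite A → Finite (Square A)
finite-Square FA = finite-× FA FA

pair : ∀ {A : Set} → (Bool → A) → Square A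
pair f = f true , f false

select : ∀ {A : Set} → Square A → Bool → A
select (a , _) true  = a
select (_ , b) false = b

select-pair : ∀ {A : Set} (f : Bool → A) b → select (pair f) b ≡ f b
select-pair f true  = refl
select-pair f false = refl

pair² : ∀ {A : Set} → (Type → A) → Square (Square A)
pair² f = pair λ a → pair λ b → f (a , b)

select² : ∀ {A : Set} → Square (Square A) → Type → A
select² t (a , b) = select (select t a) b

select²-pair² : ∀ {A : Set} (f : Type → A) τ → select² (pair² f) τ ≡ f τ
select²-pair² f (true  , b) = select-pair (λ b → f (true , b)) b
select²-pair² f (false , b) = select-pair (λ b → f (false , b)) b

-- The functions Type → Type → Bool → K, as a manifestly finite type.
Table : Set → Set
Table K = Square (Square (Square (Square (Square K))))

finite-Table : ∀ {K} → Finite K → Finite (Table K)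
finite-Table FK = finite-Square (finite-Square (finite-Square (finite-Square (finite-Square FK))))

read : ∀ {K} → Table K → Type → Type → Bool → K
read t σ τ c = select (select² (select² t σ) τ) c

tabulate : ∀ {K} → (Type → Type → Bool → K) → Table K
tabulate f = pair² λ σ → pair² λ τ → pair (f σ τ)

read-tabulate : ∀ {K} (f : Type → Type → Bool → K) σ τ c → read (tabulate f) σ τ c ≡ f σ τ c
read-tabulate f σ τ c =
  trans (cong (λ t → select (select² t τ) c) (select²-pair² (λ σ → pair² λ τ → pair (f σ τ)) σ))
  (trans (cong (λ t → select t c) (select²-pair² (λ τ → pair (f σ τ)) τ))
  (select-pair (f σ τ) c))

entry : ∀ {n} → Vec Bool n → ℕ → Bool
entry []      _       = false
entry (b ∷ r) zero    = b
entry (b ∷ r) (suc j) = entry r j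

row : (ℕ → Bool) → ∀ n → Vec Bool n
row f zero    = []
row f (suc n) = f 0 ∷ row (f ∘ suc) n

entry-row : ∀ f {n j} → j < n → entry (row f n) j ≡ f j
entry-row f {suc n} {zero}  _         = refl
entry-row f {suc n} {suc j} (s≤s j<n) = entry-row (f ∘ suc) j<n

nth : List ℕ → ℕ → ℕ
nth []       _       = 0
nth (x ∷ xs) zero    = x
nth (x ∷ xs) (suc i) = nth xs i

All-nth : ∀ {P : ℕ → Set} {xs} → All P xs → ∀ {i} → i < length xs → P (nth xs i)
All-nth (p ∷ ps) {zero}  _        = p
All-nth (p ∷ ps) {suc i} (s≤s i<) = All-nth ps i<

AllPairs-nth : ∀ {R : ℕ → ℕ → Set} {xs} → AllPairs R xs → ∀ {i j} → i < j → j < length xs → R (nth xs i) (nth xs j)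
AllPairs-nth (p ∷ ps) {zero}  {suc j} _         (s≤s j<) = All-nth p j<
AllPairs-nth (p ∷ ps) {suc i} {suc j} (s≤s i<j) (s≤s j<) = AllPairs-nth ps i<j j<

-- Embedding finite graphs over a finite base

module Embeddings (em : ExcludedMiddle 0ℓ) {E : Rel₂} (random : IsRandomGraph E) where
  open RandomGraph em random

  module _ {W : Set} (P : W → W → Bool) (P-sym : ∀ w w′ → P w w′ ≡ P w′ w)
           (base : List V) (t : W → V → Bool) where

    -- One vertex is added at a time by `realize`, which prescribes its adjacencies to the base and
    -- to the vertices already placed.
    embed : (ws : List W) → Σ (W → V) λ e →
      (∀ {w} → w ∈ ws → e w ∉ base × (∀ {x} → x ∈ base → adj (e w) x ≡ t w x)) ×
      (∀ {w w′} → w ∈ ws → w′ ∈ ws → w ≢ w′ → e w ≢ e w′ × adj (e w) (e w′) ≡ P w w′)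
    embed []       = (λ _ → 0) , (λ ()) , (λ ())
    embed (w₀ ∷ ws) with embed ws | em {w₀ ∈ ws}
    ... | e , typed , faithful | yes w₀∈ =
      e , typed ∘ absorb , λ w∈ w′∈ → faithful (absorb w∈) (absorb w′∈)
      where
      absorb : ∀ {w} → w ∈ w₀ ∷ ws → w ∈ ws
      absorb (here refl) = w₀∈
      absorb (there w∈)  = w∈
    ... | e , typed , faithful | no w₀∉ = e₁ , typed₁ , faithful₁
      where
      Neighbour : V → Set
      Neighbour x = Σ W λ w → w ∈ ws × e w ≡ x × P w₀ w ≡ true
      c : V → Bool
      -- The images placed so far lie outside the base and determine their preimages in `ws`, so the
      -- two prescriptions do not conflict.
      c x = if does (em {x ∈ base}) then t w₀ x else does (em {Neighbour x})
      v,spec = realize c (base ++ᴸ mapᴸ e ws)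
      v = proj₁ v,spec
      e₁ : W → V
      e₁ w = if does (em {w ≡ w₀}) then v else e w
      e₁-new : e₁ w₀ ≡ v
      e₁-new rewrite dec-true (em {w₀ ≡ w₀}) refl = refl
      e₁-old : ∀ {w} → w ∈ ws → e₁ w ≡ e w
      e₁-old {w} w∈ rewrite dec-false (em {w ≡ w₀}) (λ { refl → w₀∉ w∈ }) = refl
      c-base : ∀ {x} → x ∈ base → c x ≡ t w₀ x
      c-base {x} x∈ rewrite dec-true (em {x ∈ base}) x∈ = refl
      c-image : ∀ {w} → w ∈ ws → c (e w) ≡ P w₀ w
      c-image {w} w∈ rewrite dec-false (em {e w ∈ base}) (proj₁ (typed w∈)) with P w₀ w in eq
      ... | true  = dec-true em (w , w∈ , refl , eq)
      ... | false = dec-false em λ (w′ , w′∈ , same , eq′) → coincide w′ w′∈ same eq′ (em {w′ ≡ w})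
        where
        coincide : ∀ w′ → w′ ∈ ws → e w′ ≡ e w → P w₀ w′ ≡ true → Dec (w′ ≡ w) → ⊥
        coincide w′ w′∈ same eq′ (yes refl) with trans (sym eq) eq′
        ... | ()
        coincide w′ w′∈ same eq′ (no w′≢w) = proj₁ (faithful w′∈ w∈ w′≢w) same
      typed₁ : ∀ {w} → w ∈ w₀ ∷ ws → e₁ w ∉ base × (∀ {x} → x ∈ base → adj (e₁ w) x ≡ t w x)
      typed₁ (here refl) rewrite e₁-new =
        (λ v∈ → proj₁ (proj₂ v,spec) (∈-++⁺ˡ v∈)) , λ x∈ → trans (proj₂ (proj₂ v,spec) (∈-++⁺ˡ x∈)) (c-base x∈)
      typed₁ (there w∈) rewrite e₁-old w∈ = typed w∈
      new : ∀ {w} → w ∈ ws → v ≢ e w × adj v (e w) ≡ P w₀ w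
      new w∈ = (λ eq → proj₁ (proj₂ v,spec) (subst (_∈ _) (sym eq) ew∈))
        , trans (proj₂ (proj₂ v,spec) ew∈) (c-image w∈)
        where ew∈ = ∈-++⁺ʳ base (∈-map⁺ e w∈)
      faithful₁ : ∀ {w w′} → w ∈ w₀ ∷ ws → w′ ∈ w₀ ∷ ws → w ≢ w′ → e₁ w ≢ e₁ w′ × adj (e₁ w) (e₁ w′) ≡ P w w′
      faithful₁ (here refl) (here refl) w≢w′ = contradiction refl w≢w′
      faithful₁ (here refl) (there w′∈) _ rewrite e₁-new | e₁-old w′∈ = new w′∈
      faithful₁ {w} (there w∈) (here refl) _ rewrite e₁-new | e₁-old w∈ =
        (λ eq → proj₁ (new w∈) (sym eq)) , trans (adj-sym (e w) v) (trans (proj₂ (new w∈)) (P-sym w₀ w))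
      faithful₁ (there w∈) (there w′∈) w≢w′ rewrite e₁-old w∈ | e₁-old w′∈ = faithful w∈ w′∈ w≢w′

  HasType : V → V → Type → V → Set
  HasType c₁ c₂ (b₁ , b₂) v = v ≢ c₁ × v ≢ c₂ × adj v c₁ ≡ b₁ × adj v c₂ ≡ b₂

  module Partite {K : Set} (FK : Finite K) (κ : V → V → K) {c₁ c₂ : V} (c₁≢c₂ : c₁ ≢ c₂) (n : ℕ) where

    -- The part (j , τ) is to be realised by vertices of type τ.
    Part : Set
    Part = ℕ × Type

    -- An n-partite graph with a copy of Q in each part: only the adjacencies between parts whose
    -- first components are increasing are relevant.
    System : Set → Set
    System Q = Part → Q → Part → Q → Bool

    record Embedding {Q : Set} (P : System Q) (e : Part → Q → V) : Set where
      field
        typed    : ∀ {j τ} x → j < n → HasType c₁ c₂ τ (e (j , τ) x)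
        faithful : ∀ i x i′ y → proj₁ i < proj₁ i′ → proj₁ i′ < n →
                   e i x ≢ e i′ y × adj (e i x) (e i′ y) ≡ P i x i′ y

    -- One task of the construction: two parts and an adjacency, such that all pairs between the
    -- parts with this adjacency are to receive the same colour.
    Step : Set
    Step = Part × Part × Bool

    Homogeneous : {Q : Set} → System Q → (Part → Q → V) → Step → Set
    Homogeneous P e (i , i′ , b) = proj₁ i < proj₁ i′ →
      ∃ λ k → ∀ x y → P i x i′ y ≡ b → κ (e i x) (e i′ y) ≡ k

    embed-system : ∀ {Q} → Finite Q → (P : System Q) → Σ (Part → Q → V) (Embedding P)
    embed-system {Q} FQ P with embed S S-sym (c₁ ∷ c₂ ∷ []) t ws
      where
      W : Set
      W = Part × Q
      S : W → W → Bool
      -- The graph reads the directed system from the part with the smaller first component; pairs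
      -- with equal first components get the default `false`.
      S ((j , τ) , x) ((j′ , τ′) , y) with ℕ.<-cmp j j′
      ... | tri< _ _ _ = P (j , τ) x (j′ , τ′) y
      ... | tri≈ _ _ _ = false
      ... | tri> _ _ _ = P (j′ , τ′) y (j , τ) x
      S-sym : ∀ w w′ → S w w′ ≡ S w′ w
      S-sym ((j , τ) , x) ((j′ , τ′) , y) with ℕ.<-cmp j j′ | ℕ.<-cmp j′ j
      ... | tri< _ _ _ | tri> _ _ _ = refl
      ... | tri> _ _ _ | tri< _ _ _ = refl
      ... | tri≈ _ _ _ | tri≈ _ _ _ = refl
      ... | tri< lt _ _ | tri< gt _ _ = contradiction gt (ℕ.<⇒≯ lt)
      ... | tri< _ ne _ | tri≈ _ eq _ = contradiction (sym eq) ne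
      ... | tri> _ _ gt | tri> _ _ lt = contradiction gt (ℕ.<⇒≯ lt)
      ... | tri> _ ne _ | tri≈ _ eq _ = contradiction (sym eq) ne
      ... | tri≈ _ eq _ | tri< _ ne _ = contradiction (sym eq) ne
      ... | tri≈ _ eq _ | tri> _ ne _ = contradiction (sym eq) ne
      t : W → V → Bool
      t ((_ , b₁ , b₂) , _) v = if does (em {v ≡ c₁}) then b₁ else b₂
      ws = cartesianProduct (cartesianProduct (upTo n) (elements finite-Type)) (elements FQ)
    ... | e , typed , faithful = e₁ , record { typed = typed′ ; faithful = faithful′ }
      where
      e₁ : Part → Q → V
      e₁ i x = e (i , x)
      listed : ∀ {j τ} x → j < n →
        ((j , τ) , x) ∈ cartesianProduct (cartesianProduct (upTo n) (elements finite-Type)) (elements FQ)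
      listed {τ = τ} x j<n =
        ∈-cartesianProduct⁺ (∈-cartesianProduct⁺ (∈-upTo⁺ j<n) (complete finite-Type τ)) (complete FQ x)
      typed′ : ∀ {j τ} x → j < n → HasType c₁ c₂ τ (e ((j , τ) , x))
      typed′ {j} {b₁ , b₂} x j<n with typed (listed x j<n)
      ... | fresh , matches = (λ eq → fresh (here eq)) , (λ eq → fresh (there (here eq)))
        , trans (matches (here refl)) at-c₁ , trans (matches (there (here refl))) at-c₂
        where
        at-c₁ : (if does (em {c₁ ≡ c₁}) then b₁ else b₂) ≡ b₁
        at-c₁ rewrite dec-true (em {c₁ ≡ c₁}) refl = refl
        at-c₂ : (if does (em {c₂ ≡ c₁}) then b₁ else b₂) ≡ b₂
        at-c₂ rewrite dec-false (em {c₂ ≡ c₁}) (c₁≢c₂ ∘ sym) = refl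
      faithful′ : ∀ i x i′ y → proj₁ i < proj₁ i′ → proj₁ i′ < n →
        e (i , x) ≢ e (i′ , y) × adj (e (i , x)) (e (i′ , y)) ≡ P i x i′ y
      faithful′ i x i′ y lt lt′
        with faithful (listed x (ℕ.<-trans lt lt′)) (listed y lt′) (λ { refl → ℕ.<-irrefl refl lt })
      ... | ne , eq with ℕ.<-cmp (proj₁ i) (proj₁ i′)
      ...   | tri< _ _ _ = ne , eq
      ...   | tri≈ _ eq′ _ = contradiction eq′ (ℕ.<⇒≢ lt)
      ...   | tri> _ _ gt = contradiction gt (ℕ.<⇒≯ lt)

    module Amalgam {Q : Set} (FQ : Finite Q) (P : System Q) (i₀ i₁ : Part) (b : Bool)
                   (i₀<i₁ : proj₁ i₀ < proj₁ i₁) where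

      Special : Part → Set
      Special i = i ≡ i₀ ⊎ i ≡ i₁

      -- A copy of P in the amalgam is given by a combinatorial line, whose letters are the pairs of
      -- P between the parts i₀ and i₁ of adjacency b. The index d stands for a moving position of
      -- the line: there the vertices outside of i₀ and i₁ look up which letters the others carry.
      amalgam : ∀ {N} → System (Vec Q N × Fin N)
      amalgam i (w , d) i′ (w′ , d′) with em {i ≡ i₀ × i′ ≡ i₁}
      ... | yes _ = if does (em {∀ c → P i₀ (lookup w c) i₁ (lookup w′ c) ≡ b}) then b else not b
      ... | no _ with em {Special i}
      ...   | yes _ = P i (lookup w d′) i′ (lookup w′ d′)
      ...   | no _  = P i (lookup w d) i′ (lookup w′ d)

      module Copy {A : Set} (letter : A → Q × Q)
                  (letter-edge : ∀ a → P i₀ (proj₁ (letter a)) i₁ (proj₂ (letter a)) ≡ b)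
                  {N : ℕ} (L : Vec (Maybe A) (suc N)) (d : Fin (suc N)) (moves : lookup L d ≡ nothing) where

        -- A moving position receives `x` itself. At a fixed position the parts `i₀` and `i₁` take
        -- the components of the constant letter; other parts repeat `x`, since their adjacencies
        -- are read at the position `d` only.
        fill : Part → Q → Maybe A → Q
        fill i x nothing  = x
        fill i x (just a) with em {i ≡ i₀} | em {i ≡ i₁}
        ... | yes _ | _     = proj₁ (letter a)
        ... | no _  | yes _ = proj₂ (letter a)
        ... | no _  | no _  = x

        -- In the parts i₀ and i₁ the index is irrelevant for the adjacencies, and it is fixed so
        -- that the vertices there are determined by a word alone.
        copy : Part → Q → Vec Q (suc N) × Fin (suc N)
        copy i x = map (fill i x) L , (if does (em {Special i}) then zero else d)

        fill-i₀ : ∀ x a → fill i₀ x (just a) ≡ proj₁ (letter a)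
        fill-i₀ x a with em {i₀ ≡ i₀} | em {i₀ ≡ i₁}
        ... | yes _ | _ = refl
        ... | no ne | _ = contradiction refl ne

        fill-i₁ : ∀ x a → fill i₁ x (just a) ≡ proj₂ (letter a)
        fill-i₁ x a with em {i₁ ≡ i₀} | em {i₁ ≡ i₁}
        ... | yes eq | _    = contradiction (cong proj₁ (sym eq)) (ℕ.<⇒≢ i₀<i₁)
        ... | no _ | yes _ = refl
        ... | no _ | no ne = contradiction refl ne

        copy-special : ∀ {i} x → Special i → copy i x ≡ (map (fill i x) L , zero)
        copy-special {i} x sp rewrite dec-true (em {Special i}) sp = refl

        index-other : ∀ {i} x → ¬ Special i → proj₂ (copy i x) ≡ d
        index-other {i} x sp rewrite dec-false (em {Special i}) sp = refl

        lookup-copy : ∀ i x → lookup (proj₁ (copy i x)) d ≡ x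
        lookup-copy i x = trans (lookup-map d (fill i x) L) (cong (fill i x) moves)

        -- At the position `d` every copied vertex shows itself, which settles all pairs but those
        -- between `i₀` and `i₁`. For these, the fixed positions always show letters, so the test
        -- over all positions amounts to `P i₀ x i₁ y ≡ b`.
        amalgam-copy : ∀ i x i′ y → proj₁ i < proj₁ i′ → amalgam i (copy i x) i′ (copy i′ y) ≡ P i x i′ y
        amalgam-copy i x i′ y i<i′ with em {i ≡ i₀ × i′ ≡ i₁}
        ... | yes (refl , refl)
          with em {∀ c → P i₀ (lookup (proj₁ (copy i₀ x)) c) i₁ (lookup (proj₁ (copy i₁ y)) c) ≡ b}
        ...   | yes all = sym (trans
                  (cong₂ (λ x y → P i₀ x i₁ y) (sym (lookup-copy i₀ x)) (sym (lookup-copy i₁ y))) (all d))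
        ...   | no ¬all = sym (¬-not λ eq → ¬all λ c → trans
                  (cong₂ (λ x y → P i₀ x i₁ y) (lookup-map c _ L) (lookup-map c _ L)) (coordinate eq (lookup L c)))
          where
          coordinate : P i₀ x i₁ y ≡ b → ∀ l → P i₀ (fill i₀ x l) i₁ (fill i₁ y l) ≡ b
          coordinate eq nothing  = eq
          coordinate eq (just a) = trans (cong₂ (λ x y → P i₀ x i₁ y) (fill-i₀ x a) (fill-i₁ y a)) (letter-edge a)
        amalgam-copy i x i′ y i<i′ | no other with em {Special i}
        ...   | no sp  = cong₂ (λ x y → P i x i′ y) (lookup-copy i x) (lookup-copy i′ y)
        ...   | yes sp = trans
            (cong (λ c → P i (lookup (proj₁ (copy i x)) c) i′ (lookup (proj₁ (copy i′ y)) c))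
              (index-other y (ordinary sp)))
            (cong₂ (λ x y → P i x i′ y) (lookup-copy i x) (lookup-copy i′ y))
          where
          ordinary : Special i → ¬ Special i′
          ordinary (inj₁ refl) (inj₁ refl) = ℕ.<-irrefl refl i<i′
          ordinary (inj₁ refl) (inj₂ refl) = other (refl , refl)
          ordinary (inj₂ refl) (inj₁ refl) = ℕ.<-asym i<i′ i₀<i₁
          ordinary (inj₂ refl) (inj₂ refl) = ℕ.<-irrefl refl i<i′

    pull-back : ∀ {Q Q′} {P : System Q} {P′ : System Q′} {e : Part → Q′ → V} (φ : Part → Q → Q′) →
      (∀ i x i′ y → proj₁ i < proj₁ i′ → P′ i (φ i x) i′ (φ i′ y) ≡ P i x i′ y) →
      Embedding P′ e → Embedding P (λ i x → e i (φ i x))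
    pull-back φ preserves emb = record
      { typed    = λ x → Embedding.typed emb (φ _ x)
      ; faithful = λ i x i′ y lt lt′ → let ne , eq = Embedding.faithful emb i (φ i x) i′ (φ i′ y) lt lt′ in
          ne , trans eq (preserves i x i′ y lt) }

    -- What has been made homogeneous on the amalgam stays so on every copy inside it, so settling
    -- one step does not spoil the others.
    pull-back-homogeneous : ∀ {Q Q′} {P : System Q} {P′ : System Q′} {e : Part → Q′ → V} (φ : Part → Q → Q′) →
      (∀ i x i′ y → proj₁ i < proj₁ i′ → P′ i (φ i x) i′ (φ i′ y) ≡ P i x i′ y) →
      ∀ {s} → Homogeneous P′ e s → Homogeneous P (λ i x → e i (φ i x)) s
    pull-back-homogeneous φ preserves hom lt with hom lt
    ... | k , mono = k , λ x y eq → mono _ _ (trans (preserves _ x _ y lt) eq)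

    opaque
      -- The induction on `steps` generalises over the system: the amalgam for the first step is
      -- formed, the remaining steps are made homogeneous for it, and Hales-Jewett then finds in the
      -- resulting embedding a copy of `P` that settles the first step.
      partite : ∀ steps {Q} → Finite Q → (P : System Q) →
        Σ (Part → Q → V) λ e → Embedding P e × All (Homogeneous P e) steps
      partite [] FQ P with embed-system FQ P
      ... | e , emb = e , emb , []
      partite ((i₀ , i₁ , b) ∷ steps) {Q} FQ P with em {proj₁ i₀ < proj₁ i₁}
      ... | no i₀≮i₁ = let e , emb , homs = partite steps FQ P in e , emb , (λ lt → contradiction lt i₀≮i₁) ∷ homs
      ... | yes i₀<i₁ = by-letters letters refl
        where
        open Amalgam FQ P i₀ i₁ b i₀<i₁
        Between : Q × Q → Set
        Between (x , y) = P i₀ x i₁ y ≡ b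
        between? : ∀ xy → Dec (Between xy)
        between? (x , y) = P i₀ x i₁ y Bool.≟ b
        pairs : Finite (Q × Q)
        pairs = finite-× FQ FQ
        letters : List (Q × Q)
        letters = filter between? (elements pairs)
        between⇒∈ : ∀ {x y} → Between (x , y) → (x , y) ∈ letters
        between⇒∈ = ∈-filter⁺ between? (complete pairs _)
        ∈⇒between : ∀ {xy} → xy ∈ letters → Between xy
        ∈⇒between xy∈ = proj₂ (∈-filter⁻ between? {xs = elements pairs} xy∈)
        Goal : Set
        Goal = Σ (Part → Q → V) λ e → Embedding P e × All (Homogeneous P e) ((i₀ , i₁ , b) ∷ steps)
        by-letters : ∀ ls → letters ≡ ls → Goal
        by-letters [] none = let e , emb , homs = partite steps FQ P in
          e , emb , (λ _ → κ 0 0 , λ x y eq → contradiction (subst (_ ∈_) none (between⇒∈ eq)) λ ()) ∷ homs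
        by-letters (l ∷ ls) some with hales-jewett em (length ls) FK
        -- A line of length zero has no moving position, as any colouring shows. So the length is
        -- positive, and the index `zero` exists.
        ... | zero , HJ with HJ (λ _ → κ 0 0)
        ...   | _ , (() , _) , _
        by-letters (l ∷ ls) some | suc N , HJ
          with partite steps (finite-× (finite-Vec FQ (suc N)) (finite-Fin (suc N))) (amalgam {suc N})
        ... | e , emb , homs
          -- A word in the letters spells a vertex of part `i₀` and one of part `i₁`; it gets the
          -- colour of this pair in the embedded amalgam.
          with HJ (λ u → κ (e i₀ (map (λ a → proj₁ (List.lookup (l ∷ ls) a)) u , zero))
                           (e i₁ (map (λ a → proj₂ (List.lookup (l ∷ ls) a)) u , zero)))
        ... | L , (d , moves) , mono =
          _ , pull-back copy amalgam-copy emb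
          , (λ _ → C zero , homogeneous) ∷ All.map (pull-back-homogeneous {e = e} copy amalgam-copy) homs
          where
          letter : Fin (suc (length ls)) → Q × Q
          letter = List.lookup (l ∷ ls)
          open Copy letter (λ a → ∈⇒between (subst (_ ∈_) (sym some) (∈-lookup a))) L d moves
          C : Fin (suc (length ls)) → K
          C a = κ (e i₀ (map (proj₁ ∘ letter) (at L a) , zero)) (e i₁ (map (proj₂ ∘ letter) (at L a) , zero))
          filled : ∀ {i} (π : Q × Q → Q) → (∀ x a → fill i x (just a) ≡ π (letter a)) →
            ∀ a → map (fill i (π (letter a))) L ≡ map (π ∘ letter) (at L a)
          filled {i} π fills a = trans (map-cong pointwise L) (map-∘ (π ∘ letter) _ L)
            where
            pointwise : ∀ m → fill i (π (letter a)) m ≡ π (letter (Maybe.fromMaybe a m))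
            pointwise nothing   = refl
            pointwise (just a′) = fills _ a′
          homogeneous : ∀ x y → P i₀ x i₁ y ≡ b → κ (e i₀ (copy i₀ x)) (e i₁ (copy i₁ y)) ≡ C zero
          -- The pair `(x , y)` is itself a letter `a`, and its copies spell the point of the line
          -- at `a`.
          homogeneous x y eq with subst (_ ∈_) some (between⇒∈ eq)
          ... | xy∈ with index xy∈ | lookup-index xy∈
          ...   | a | refl = trans (cong₂ (λ v w → κ (e i₀ v) (e i₁ w))
                    (trans (copy-special x (inj₁ refl)) (cong (_, zero) (filled proj₁ fill-i₀ a)))
                    (trans (copy-special y (inj₂ refl)) (cong (_, zero) (filled proj₂ fill-i₁ a))))
                  (mono a)

  -- Canonical copies of graphs labelled with types

  module Canonical {K : Set} (FK : Finite K) (κ : V → V → K) {c₁ c₂ : V} (c₁≢c₂ : c₁ ≢ c₂) where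
    open Partite FK κ c₁≢c₂

    CanonicalUpTo : ℕ → Table K → Set
    CanonicalUpTo m k = (τ : ℕ → Type) (B : ℕ → ℕ → Bool) → Σ (ℕ → V) λ v →
      (∀ {i} → i < m → HasType c₁ c₂ (τ i) (v i)) ×
      (∀ {i j} → i < j → j < m → v i ≢ v j × adj (v i) (v j) ≡ B i j × κ (v i) (v j) ≡ read k (τ i) (τ j) (B i j))

    module Selection (n : ℕ) where

      -- Every vertex carries its adjacencies to all later parts.
      system : System n (Vec Bool n)
      system (j , σ) r (j′ , τ) _ = entry r j′

      parts : List (Part n)
      parts = cartesianProduct (upTo n) (elements finite-Type)

      steps : List (Step n)
      steps = cartesianProduct parts (cartesianProduct parts (elements finite-Bool))

      step-listed : ∀ {j j′} σ τ b → j < n → j′ < n → ((j , σ) , (j′ , τ) , b) ∈ steps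
      step-listed σ τ b j< j′< =
        ∈-cartesianProduct⁺ (∈-cartesianProduct⁺ (∈-upTo⁺ j<) (complete finite-Type σ))
          (∈-cartesianProduct⁺ (∈-cartesianProduct⁺ (∈-upTo⁺ j′<) (complete finite-Type τ)) (complete finite-Bool b))

      module _ (e : Part n → Vec Bool n → V) (homs : All (Homogeneous n system e) steps) where

        Colours : ℕ → ℕ → Table K → Set
        Colours j j′ t = j < j′ → j′ < n → ∀ σ τ r r′ →
          κ (e (j , σ) r) (e (j′ , τ) r′) ≡ read t σ τ (entry r j′)

        table : ∀ j j′ → Σ (Table K) (Colours j j′)
        table j j′ with em {j < j′ × j′ < n}
        -- A default table outside the range `j < j′ < n`, where `Colours` holds vacuously.
        ... | no ¬lt = tabulate (λ _ _ _ → κ 0 0) , λ j<j′ j′<n → contradiction (j<j′ , j′<n) ¬lt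
        ... | yes (j<j′ , j′<n) = tabulate (λ σ τ b → proj₁ (hom σ τ b)) , λ _ _ σ τ r r′ →
                trans (proj₂ (hom σ τ (entry r j′)) r r′ refl) (sym (read-tabulate (λ σ τ b → proj₁ (hom σ τ b)) σ τ _))
          where
          hom : ∀ σ τ b → ∃ λ k → ∀ r r′ → entry r j′ ≡ b → κ (e (j , σ) r) (e (j′ , τ) r′) ≡ k
          hom σ τ b = All.lookup homs (step-listed σ τ b (ℕ.<-trans j<j′ j′<n) j′<n) j<j′

        module _ (emb : Embedding n system e) {m : ℕ} {k : Table K} {s : ℕ → ℕ} (s<n : ∀ {i} → i < m → s i < n)
                 (s-mono : ∀ {i j} → i < j → j < m → s i < s j)
                 (s-colour : ∀ {i j} → i < j → j < m → proj₁ (table (s i) (s j)) ≡ k) where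
          open Embedding n emb

          s-injective : ∀ {i j} → i < m → j < m → s i ≡ s j → i ≡ j
          s-injective {i} {j} i<m j<m eq with ℕ.<-cmp i j
          ... | tri< i<j _ _ = contradiction eq (ℕ.<⇒≢ (s-mono i<j j<m))
          ... | tri≈ _ i≡j _ = i≡j
          ... | tri> _ _ j<i = contradiction (sym eq) (ℕ.<⇒≢ (s-mono j<i i<m))

          -- Vertex `i` is taken from the part at position `s i` with type `τ i`, and its row lists
          -- the adjacencies required to the selected positions.
          selection-canonical : CanonicalUpTo m k
          selection-canonical τ B = v , (λ i<m → typed _ (s<n i<m)) , λ {i} {j} i<j j<m →
            let ne , eq = faithful (s i , τ i) (r i) (s j , τ j) (r j) (s-mono i<j j<m) (s<n j<m) in
            ne , trans eq (entry-r i j<m) ,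
            trans (proj₂ (table (s i) (s j)) (s-mono i<j j<m) (s<n j<m) (τ i) (τ j) (r i) (r j))
                  (cong₂ (λ t b → read t (τ i) (τ j) b) (s-colour i<j j<m) (entry-r i j<m))
            where
            later : ℕ → ℕ → Bool
            -- Inverts the selection; positions that are not selected get the default `false`.
            later i l with em {Σ ℕ λ j → j < m × s j ≡ l}
            ... | yes (j , _) = B i j
            ... | no _        = false
            later-s : ∀ i {j} → j < m → later i (s j) ≡ B i j
            later-s i {j} j<m with em {Σ ℕ λ j′ → j′ < m × s j′ ≡ s j}
            ... | yes (j′ , j′<m , eq) = cong (B i) (s-injective {j′} {j} j′<m j<m eq)
            ... | no none = contradiction (j , j<m , refl) none
            r : ℕ → Vec Bool n
            r i = row (later i) n
            entry-r : ∀ i {j} → j < m → entry (r i) (s j) ≡ B i j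
            entry-r i j<m = trans (entry-row (later i) (s<n j<m)) (later-s i j<m)
            v : ℕ → V
            v i = e (s i , τ i) (r i)

      canonical-selection : ∀ m → ramsey-bound em (finite-Table FK) m ≤ n → ∃ (CanonicalUpTo m)
      canonical-selection m long with partite n steps (finite-Vec finite-Bool n) system
      ... | e , emb , homs with ramsey em (finite-Table FK) (λ j j′ → proj₁ (table e homs j j′)) m (upTo n)
                                  (ℕ.≤-trans long (ℕ.≤-reflexive (sym (length-upTo n))))
      ... | k , js , js⊆ , m≤ , mono = k , selection-canonical e homs emb {s = nth js}
        (λ i<m → All-nth (All-resp-⊆ js⊆ (All.applyUpTo⁺₁ id n id)) (ℕ.<-≤-trans i<m m≤))
        (λ i<j j<m → AllPairs-nth (AllPairs-resp-⊆ js⊆ (AllPairs.applyUpTo⁺₁ id n (λ i<j _ → i<j)))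
                                  i<j (ℕ.<-≤-trans j<m m≤))
        (λ i<j j<m → AllPairs-nth mono i<j (ℕ.<-≤-trans j<m m≤))

    canonical-up-to : ∀ m → ∃ (CanonicalUpTo m)
    canonical-up-to m = Selection.canonical-selection _ m ℕ.≤-refl

    opaque
      -- Compactness over the finitely many tables: `CanonicalUpTo` passes to smaller bounds, so if
      -- every table failed somewhere, all would fail at a common bound, against `canonical-up-to`.
      canonical : ∃ λ k → ∀ m → CanonicalUpTo m k
      canonical with uniform-or-bounded (elements (finite-Table FK))
        where
        uniform-or-bounded : ∀ ks →
          (∃ λ k → ∀ m → CanonicalUpTo m k) ⊎ (∃ λ M → ∀ {k} → k ∈ ks → ¬ CanonicalUpTo M k)
        uniform-or-bounded [] = inj₂ (0 , λ ())
        uniform-or-bounded (k ∷ ks) with uniform-or-bounded ks | em {∃ λ m → ¬ CanonicalUpTo m k}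
        ... | inj₁ uniform       | _ = inj₁ uniform
        ... | inj₂ _             | no none = inj₁ (k , λ m → decidable-stable em (λ ¬c → none (m , ¬c)))
        ... | inj₂ (M , failing) | yes (m , ¬c) = inj₂ (M ⊔ m ,
                λ { (here refl) c → ¬c (restrict (ℕ.m≤n⊔m M m) c)
                  ; (there k∈)  c → failing k∈ (restrict (ℕ.m≤m⊔n M m) c) })
          where
          restrict : ∀ {m M k} → m ≤ M → CanonicalUpTo M k → CanonicalUpTo m k
          restrict m≤M c τ B with c τ B
          ... | v , typed , faithful =
            v , (λ i< → typed (ℕ.<-≤-trans i< m≤M)) , λ i<j j< → faithful i<j (ℕ.<-≤-trans j< m≤M)
      ... | inj₁ uniform = uniform
      ... | inj₂ (M , failing) = contradiction (proj₂ (canonical-up-to M)) (failing (complete (finite-Table FK) _))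

-- Closed monoids containing the automorphisms

unordered : ∀ {N} (R : ℕ → ℕ → Set) → (∀ {i j} → R i j → R j i) →
  (∀ {i j} → i < j → j < N → R i j) → ∀ {i j} → i < N → j < N → i ≢ j → R i j
unordered R R-sym ordered {i} {j} i<N j<N i≢j with ℕ.<-cmp i j
... | tri< i<j _ _ = ordered i<j j<N
... | tri≈ _ i≡j _ = contradiction i≡j i≢j
... | tri> _ _ j<i = R-sym (ordered j<i i<N)

Identical Negating : (Bool → Bool) → Set
Identical f = ∀ b → f b ≡ b
Negating  f = ∀ b → f b ≡ not b

boolean-function : ∀ f → Identical f ⊎ Negating f ⊎ (∃ λ c → ∀ b → f b ≡ c)
boolean-function f with f true in t | f false in e
... | true  | true  = inj₂ (inj₂ (true  , λ { true → t ; false → e }))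
... | true  | false = inj₁ λ { true → t ; false → e }
... | false | true  = inj₂ (inj₁ λ { true → t ; false → e })
... | false | false = inj₂ (inj₂ (false , λ { true → t ; false → e }))

fresh-value : (em : ExcludedMiddle 0ℓ) (L : List V) {N : ℕ} (f : ℕ → V) → length L < N →
  (∀ {i j} → i < j → j < N → f i ≢ f j) → ∃ λ k → k < N × f k ∉ L
fresh-value em L {N} f short distinct with em {∃ λ k → k < N × f k ∉ L}
... | yes fresh = fresh
... | no none = contradiction
    (trans (lookup-index (hit i)) (trans (cong (List.lookup L) same) (sym (lookup-index (hit j)))))
    (distinct i<j (Fin.toℕ<n j))
  where
  hit : (i : Fin N) → f (toℕ i) ∈ L
  hit i = decidable-stable em λ miss → none (toℕ i , Fin.toℕ<n i , miss)
  collision = Fin.pigeonhole short (λ i → index (hit i))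
  i = proj₁ collision
  j = proj₁ (proj₂ collision)
  i<j = proj₁ (proj₂ (proj₂ collision))
  same = proj₂ (proj₂ (proj₂ collision))

module Monoid (em : ExcludedMiddle 0ℓ) {E : Rel₂} (random : IsRandomGraph E)
  (M : (V → V) → Set)
  (∘-closed : ∀ f g → M f → M g → M (f ∘ g))
  (M-aut : ∀ {α} → IsGraphAut E α → M α)
  (M-closed : ∀ f → (∀ N → Σ (V → V) λ g → M g × (∀ {i} → i < N → g i ≡ f i)) → M f) where
  open RandomGraph em random
  open Embeddings em random

  M-∘ : ∀ {f g} → M f → M g → M (f ∘ g)
  M-∘ = ∘-closed _ _

  M-id : M id
  M-id = M-aut id-aut

  opaque
    move : ∀ N (p q : ℕ → V) →
      (∀ {i j} → i < j → j < N → p i ≢ p j × q i ≢ q j × adj (p i) (p j) ≡ adj (q i) (q j)) →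
      Σ (V → V) λ α → M α × (∀ {i} → i < N → α (p i) ≡ q i)
    move N p q ordered = let α , aut , moves = homogeneity N p q compatible in α , M-aut aut , moves
      where
      compatible : ∀ {i j} → i < N → j < N → Compatible (p i , q i) (p j , q j)
      compatible {i} {j} i<N j<N with ℕ.<-cmp i j
      ... | tri≈ _ refl _ = (λ _ → refl) , (λ _ → refl) , trans (adj-irrefl (p i)) (sym (adj-irrefl (q i)))
      ... | tri< i<j _ _ = let pne , qne , eq = ordered i<j j<N in
              (λ eq → contradiction eq pne) , (λ eq → contradiction eq qne) , eq
      ... | tri> _ _ j<i = let pne , qne , eq = ordered j<i i<N in
              (λ eq → contradiction (sym eq) pne) , (λ eq → contradiction (sym eq) qne)
              , trans (adj-sym (p i) (p j)) (trans eq (adj-sym (q j) (q i)))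

  Approximates : (V → V) → ℕ → (V → V) → Set
  Approximates F N h = ∀ {i j} → i < j → j < N → h i ≢ h j × adj (h i) (h j) ≡ adj (F i) (F j)

  -- Only the adjacencies of `F` matter: by homogeneity an automorphism carries the values of `h` on
  -- an initial segment to those of `F`, and `M` is closed.
  approximable : ∀ {F} → Injective _≡_ _≡_ F → (∀ N → Σ (V → V) λ h → M h × Approximates F N h) → M F
  approximable {F} F-inj approx = M-closed F λ N → let h , Mh , like = approx N in
    let α , Mα , moves = move N h F (λ i<j j<N → let ne , eq = like i<j j<N in
                           ne , (λ same → ℕ.<⇒≢ i<j (F-inj same)) , eq)
    in α ∘ h , M-∘ Mα Mh , moves

  -- Tasks are treated one at a time; since `step` never undoes a completed task, all of them are
  -- completed at the end.
  iterate : ∀ {T : Set} (Done : T → (V → V) → Set) →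
    (∀ t {p} → M p → Σ (V → V) λ p′ → M p′ × Done t p′ × (∀ {t′} → Done t′ p → Done t′ p′)) →
    ∀ ts → Σ (V → V) λ p → M p × (∀ {t} → t ∈ ts → Done t p)
  iterate Done step [] = id , M-id , λ ()
  iterate Done step (t ∷ ts) with iterate Done step ts
  ... | p , Mp , done with step t Mp
  ... | p′ , Mp′ , now , keep = p′ , Mp′ , λ { (here refl) → now ; (there t∈) → keep (done t∈) }

  -- Maps that identify vertices

  Collapses : Bool → Set
  Collapses b = Σ (V → V) λ g → M g × (∃₂ λ x y → x ≢ y × adj x y ≡ b × g x ≡ g y)

  collapse : ∀ {b} → Collapses b → ∀ {x y} → x ≢ y → adj x y ≡ b → Σ (V → V) λ h → M h × h x ≡ h y
  collapse (g , Mg , x₀ , y₀ , x₀≢y₀ , adj₀ , same) {x} {y} x≢y adj-xy =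
    g ∘ α , M-∘ Mg Mα , trans (cong g (moves z<s)) (trans same (sym (cong g (moves (s<s z<s)))))
    where
    tuple : V → V → ℕ → V
    tuple x y zero    = x
    tuple x y (suc _) = y
    moving : Σ (V → V) λ α → M α × (∀ {i} → i < 2 → α (tuple x y i) ≡ tuple x₀ y₀ i)
    moving = move 2 (tuple x y) (tuple x₀ y₀) λ { {zero} {suc zero} _ _ → x≢y , x₀≢y₀ , trans adj-xy (sym adj₀)
      ; {suc _} {suc zero} (s≤s ()) _ ; {_} {suc (suc _)} _ (s≤s (s≤s ())) }
    α = proj₁ moving
    Mα = proj₁ (proj₂ moving)
    moves = proj₂ (proj₂ moving)

  constant : (∀ b → Collapses b) → M (const 0)
  constant collapses = M-closed (const 0) λ N → to-zero N (iterate Done step (cartesianProduct (upTo N) (upTo N)))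
    where
    Done : ℕ × ℕ → (V → V) → Set
    Done (i , j) p = p i ≡ p j
    step : ∀ t {p} → M p → Σ (V → V) λ p′ → M p′ × Done t p′ × (∀ {t′} → Done t′ p → Done t′ p′)
    step (i , j) {p} Mp with p i ℕ.≟ p j
    ... | yes eq = p , Mp , eq , id
    ... | no ne = let h , Mh , same = collapse (collapses _) ne refl in h ∘ p , M-∘ Mh Mp , same , cong h
    to-zero : ∀ N → (Σ (V → V) λ p → M p × (∀ {t} → t ∈ cartesianProduct (upTo N) (upTo N) → Done t p)) →
      Σ (V → V) λ g → M g × (∀ {i} → i < N → g i ≡ 0)
    to-zero zero    (p , Mp , done) = p , Mp , λ ()
    to-zero (suc N) (p , Mp , done) =
      -- All values below the bound agree with `p 0` by now; an automorphism takes this vertex to 0.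
      let α , Mα , moves = move 1 (const (p 0)) (const 0) λ { {_} {zero} () _ ; {_} {suc _} _ (s≤s ()) } in
      α ∘ p , M-∘ Mα Mp , λ i< →
        trans (cong α (done (∈-cartesianProduct⁺ (∈-upTo⁺ i<) (∈-upTo⁺ z<s)))) (moves {0} z<s)

  module Half (b : Bool) (collapses : Collapses b) (rigid : ¬ Collapses (not b)) where

    -- If the image pair had adjacency `b`, a further map could identify it, and the composition
    -- would collapse a pair of adjacency `not b`.
    preserves : ∀ {h} → M h → ∀ {x y} → x ≢ y → adj x y ≡ not b → h x ≢ h y × adj (h x) (h y) ≡ not b
    preserves {h} Mh {x} {y} x≢y adj-xy = distinct , kept
      where
      distinct : h x ≢ h y
      distinct same = rigid (h , Mh , x , y , x≢y , adj-xy , same)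
      kept : adj (h x) (h y) ≡ not b
      kept = ¬-not λ adj-h → let h′ , Mh′ , same = collapse collapses distinct adj-h in
        rigid (h′ ∘ h , M-∘ Mh′ Mh , x , y , x≢y , adj-xy , same)

    W : Set
    W = ℕ × ℕ

    -- Every vertex i is blown up to a set of vertices (i , k) that are joined by not b, so that no two
    -- of them are identified by M.
    blow-up : W → W → Bool
    blow-up (i , _) (j , _) = if does (em {i ≡ j}) then not b else adj i j

    blow-up-sym : ∀ w w′ → blow-up w w′ ≡ blow-up w′ w
    blow-up-sym (i , _) (j , _) with em {i ≡ j} | em {j ≡ i}
    ... | yes _    | yes _    = refl
    ... | no _     | no _     = adj-sym i j
    ... | yes refl | no ne    = contradiction refl ne
    ... | no ne    | yes refl = contradiction refl ne

    -- In the blow-up, all pairs of adjacency `b` are identified in turn. Copies of one vertex stay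
    -- distinct, so copies with pairwise distinct images can be chosen, one for each vertex; they
    -- induce the initial segment, and their images have pairwise adjacency `not b`.
    monochromatic : ∀ N → Σ (V → V) λ h → M h × (∀ {i j} → i < j → j < N → h i ≢ h j × adj (h i) (h j) ≡ not b)
    monochromatic N with embed blow-up blow-up-sym [] (λ _ _ → b) ws
      where
      ws = cartesianProduct (upTo N) (upTo N)
    ... | e , _ , faithful with iterate Done step (cartesianProduct ws ws)
      where
      ws = cartesianProduct (upTo N) (upTo N)
      Done : W × W → (V → V) → Set
      Done (w , w′) p = p (e w) ≡ p (e w′) ⊎ p (e w) ≢ p (e w′) × adj (p (e w)) (p (e w′)) ≡ not b
      keep : ∀ {h} → M h → ∀ {x y} → x ≡ y ⊎ x ≢ y × adj x y ≡ not b →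
        h x ≡ h y ⊎ h x ≢ h y × adj (h x) (h y) ≡ not b
      keep {h} Mh (inj₁ eq)        = inj₁ (cong h eq)
      keep     Mh (inj₂ (ne , eq)) = inj₂ (preserves Mh ne eq)
      step : ∀ t {p} → M p → Σ (V → V) λ p′ → M p′ × Done t p′ × (∀ {t′} → Done t′ p → Done t′ p′)
      step (w , w′) {p} Mp with p (e w) ℕ.≟ p (e w′) | adj (p (e w)) (p (e w′)) Bool.≟ b
      ... | yes same | _ = p , Mp , inj₁ same , id
      ... | no ne | no eq = p , Mp , inj₂ (ne , ¬-not eq) , id
      ... | no ne | yes eq = let h , Mh , same = collapse collapses ne eq in h ∘ p , M-∘ Mh Mp , inj₁ same , keep Mh
    ... | h , Mh , done = transversal (choose N ℕ.≤-refl)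
      where
      listed : ∀ {i k} → i < N → k < N → (i , k) ∈ cartesianProduct (upTo N) (upTo N)
      listed i<N k<N = ∈-cartesianProduct⁺ (∈-upTo⁺ i<N) (∈-upTo⁺ k<N)
      copies-distinct : ∀ {i} → i < N → ∀ {k l} → k < l → l < N → h (e (i , k)) ≢ h (e (i , l))
      copies-distinct {i} i<N k<l l<N
        with faithful (listed i<N (ℕ.<-trans k<l l<N)) (listed i<N l<N) (λ { refl → ℕ.<-irrefl refl k<l })
      ... | ne , eq = proj₁ (preserves Mh ne (trans eq copies))
        where
        copies : (if does (em {i ≡ i}) then not b else adj i i) ≡ not b
        copies rewrite dec-true (em {i ≡ i}) refl = refl
      Transversal : ℕ → (ℕ → ℕ) → Set
      Transversal m f = (∀ {i} → i < m → f i < N) × (∀ {i j} → i < j → j < m → h (e (i , f i)) ≢ h (e (j , f j)))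
      choose : ∀ m → m ≤ N → Σ (ℕ → ℕ) (Transversal m)
      choose zero    _   = id , (λ ()) , λ _ ()
      choose (suc m) m<N with choose m (ℕ.<⇒≤ m<N)
      ... | f , bounded , distinct
        -- The `N` copies of `m` have distinct images, and only `m < N` images are taken so far.
        with fresh-value em (mapᴸ (λ i → h (e (i , f i))) (upTo m)) (λ k → h (e (m , k)))
               (subst (_< N) (sym (trans (length-map _ (upTo m)) (length-upTo m))) m<N) (copies-distinct m<N)
      ...   | k , k<N , fresh = f₁ , bounded₁ , distinct₁
        where
        f₁ : ℕ → ℕ
        f₁ i = if does (em {i ≡ m}) then k else f i
        f₁-new : f₁ m ≡ k
        f₁-new rewrite dec-true (em {m ≡ m}) refl = refl
        f₁-old : ∀ {i} → i < m → f₁ i ≡ f i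
        f₁-old {i} i<m rewrite dec-false (em {i ≡ m}) (ℕ.<⇒≢ i<m) = refl
        bounded₁ : ∀ {i} → i < suc m → f₁ i < N
        bounded₁ i< with ℕ.m<1+n⇒m<n∨m≡n i<
        ... | inj₁ i<m rewrite f₁-old i<m = bounded i<m
        ... | inj₂ refl rewrite f₁-new = k<N
        distinct₁ : ∀ {i j} → i < j → j < suc m → h (e (i , f₁ i)) ≢ h (e (j , f₁ j))
        distinct₁ i<j j< with ℕ.m<1+n⇒m<n∨m≡n j<
        ... | inj₁ j<m rewrite f₁-old (ℕ.<-trans i<j j<m) | f₁-old j<m = distinct i<j j<m
        ... | inj₂ refl rewrite f₁-old i<j | f₁-new = λ same →
                fresh (subst (_∈ mapᴸ (λ i → h (e (i , f i))) (upTo m)) same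
                         (∈-map⁺ (λ i → h (e (i , f i))) (∈-upTo⁺ i<j)))
      transversal : Σ (ℕ → ℕ) (Transversal N) →
        Σ (V → V) λ h → M h × (∀ {i j} → i < j → j < N → h i ≢ h j × adj (h i) (h j) ≡ not b)
      transversal (f , bounded , distinct) with move N id (λ i → e (i , f i)) like
        where
        like : ∀ {i j} → i < j → j < N →
          i ≢ j × e (i , f i) ≢ e (j , f j) × adj i j ≡ adj (e (i , f i)) (e (j , f j))
        like {i} {j} i<j j<N
          with faithful (listed i<N (bounded i<N)) (listed j<N (bounded j<N)) (λ { refl → ℕ.<-irrefl refl i<j })
          where i<N = ℕ.<-trans i<j j<N
        ... | ne , eq = ℕ.<⇒≢ i<j , ne , sym (trans eq between)
          where
          between : (if does (em {i ≡ j}) then not b else adj i j) ≡ adj i j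
          between rewrite dec-false (em {i ≡ j}) (ℕ.<⇒≢ i<j) = refl
      ... | α , Mα , moves = h ∘ α , M-∘ Mh Mα , result
        where
        result : ∀ {i j} → i < j → j < N → h (α i) ≢ h (α j) × adj (h (α i)) (h (α j)) ≡ not b
        result {i} {j} i<j j<N rewrite moves (ℕ.<-trans i<j j<N) | moves j<N = ne , eq
          where
          i<N = ℕ.<-trans i<j j<N
          ne = distinct i<j j<N
          eq : adj (h (e (i , f i))) (h (e (j , f j))) ≡ not b
          eq with done (∈-cartesianProduct⁺ (listed i<N (bounded i<N)) (listed j<N (bounded j<N)))
          ... | inj₁ same    = contradiction same ne
          ... | inj₂ (_ , eq) = eq

  injective : (∀ b → ¬ Collapses b) → ∀ {h} → M h → Injective _≡_ _≡_ h
  injective rigid {h} Mh {x} {y} same =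
    decidable-stable (x ℕ.≟ y) λ x≢y → rigid _ (h , Mh , x , y , x≢y , refl , same)

  -- Monoids of injective maps

  module Rigid (rigid : ∀ b → ¬ Collapses b) where

    PatternBelow : (V → V → Bool) → ℕ → (V → V) → Set
    PatternBelow B N h = ∀ {i j} → i < j → j < N → adj (h i) (h j) ≡ B i j

    Attains : (V → V → Bool) → Set
    Attains B = ∀ N → Σ (V → V) λ h → M h × PatternBelow B N h

    attains : ∀ {F} → Injective _≡_ _≡_ F → Attains (λ i j → adj (F i) (F j)) → M F
    attains F-inj attain = approximable F-inj λ N → let h , Mh , pattern′ = attain N in
      h , Mh , λ i<j j<N → (λ same → ℕ.<⇒≢ i<j (injective rigid Mh same)) , pattern′ i<j j<N

    switched : V → V → V → Bool
    switched a x y = if does (em {x ≡ a ⊎ y ≡ a}) then not (adj x y) else adj x y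

    -- The effect is relative to an arbitrary `p` in `M` and concerns an initial segment, so
    -- operations at different vertices can be iterated before passing to the limit.
    StarOperation : (Bool → Bool) → Set
    StarOperation f = ∀ {p} → M p → ∀ N {x} → x < N → Σ (V → V) λ p′ → M p′ ×
      (∀ {j} → j < N → j ≢ x → adj (p′ x) (p′ j) ≡ f (adj (p x) (p j))) ×
      (∀ {i j} → i < N → j < N → i ≢ j → i ≢ x → j ≢ x → adj (p′ i) (p′ j) ≡ adj (p i) (p j))

    -- A later operation at another vertex changes only pairs with that vertex, and these get the
    -- value `c` too; so finished stars stay finished.
    star-constant : ∀ {f c} → StarOperation f → (∀ b → f b ≡ c) → Attains (λ _ _ → c)
    star-constant {f} {c} star const-f N = let p , Mp , done = iterate Done step (upTo N) in
      p , Mp , λ i<j j<N → let i<N = ℕ.<-trans i<j j<N in done (∈-upTo⁺ i<N) i<N j<N (ℕ.>⇒≢ i<j)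
      where
      Done : ℕ → (V → V) → Set
      Done x p = x < N → ∀ {j} → j < N → j ≢ x → adj (p x) (p j) ≡ c
      step : ∀ x {p} → M p → Σ (V → V) λ p′ → M p′ × Done x p′ × (∀ {x′} → Done x′ p → Done x′ p′)
      step x {p} Mp with x ℕ.<? N
      ... | no x≮N = p , Mp , (λ x<N → contradiction x<N x≮N) , id
      ... | yes x<N with star Mp N x<N
      ...   | p′ , Mp′ , at-x , elsewhere = p′ , Mp′ , (λ _ → now) , keep
        where
        now : ∀ {j} → j < N → j ≢ x → adj (p′ x) (p′ j) ≡ c
        now j<N j≢x = trans (at-x j<N j≢x) (const-f _)
        keep : ∀ {x′} → Done x′ p → Done x′ p′
        keep {x′} done x′<N {j} j<N j≢x′ with x′ ℕ.≟ x | j ℕ.≟ x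
        ... | yes refl | _        = now j<N j≢x′
        ... | no x′≢x  | yes refl = trans (adj-sym (p′ x′) (p′ j)) (now x′<N x′≢x)
        ... | no x′≢x  | no j≢x   = trans (elsewhere x′<N j<N (j≢x′ ∘ sym) x′≢x j≢x) (done x′<N j<N j≢x′)

    star-negating : ∀ {f} → StarOperation f → Negating f → ∀ a → Attains (switched a)
    -- The bound is enlarged so that `a` itself lies below it.
    star-negating {f} star negates a N with star M-id (N ⊔ suc a) {a} (ℕ.m≤n⊔m N (suc a))
    ... | p , Mp , at-a , elsewhere = p , Mp , λ i<j j<N → pattern′ i<j j<N
      where
      widen : ∀ {i} → i < N → i < N ⊔ suc a
      widen i<N = ℕ.<-≤-trans i<N (ℕ.m≤m⊔n N (suc a))
      pattern′ : ∀ {i j} → i < j → j < N → adj (p i) (p j) ≡ switched a i j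
      pattern′ {i} {j} i<j j<N with em {i ≡ a ⊎ j ≡ a}
      ... | yes (inj₁ refl) = trans (at-a (widen j<N) (ℕ.>⇒≢ i<j)) (negates _)
      ... | yes (inj₂ refl) = trans (adj-sym (p i) (p j))
              (trans (at-a (widen (ℕ.<-trans i<j j<N)) (ℕ.<⇒≢ i<j)) (trans (negates _) (cong not (adj-sym j i))))
      ... | no other = elsewhere (widen (ℕ.<-trans i<j j<N)) (widen j<N) (ℕ.<⇒≢ i<j) (other ∘ inj₁) (other ∘ inj₂)

    module _ (no-constant : ∀ c → ¬ Attains (λ _ _ → c))
             (no-negation : ¬ Attains (λ x y → not (adj x y)))
             (no-switch : ∃ λ a → ¬ Attains (switched a)) where

      star-identical : ∀ {f} → StarOperation f → Identical f
      star-identical {f} star with boolean-function f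
      ... | inj₁ identical               = identical
      ... | inj₂ (inj₁ negates)          =
              contradiction (star-negating star negates (proj₁ no-switch)) (proj₂ no-switch)
      ... | inj₂ (inj₂ (c , constant-f)) = contradiction (star-constant star constant-f) (no-constant c)

      module _ {g : V → V} (Mg : M g) {c₁ c₂ : V} (c₁≢c₂ : c₁ ≢ c₂) where

        -- The last two components depend on `v` alone; with them the table also controls the action
        -- of `g` on the pairs with a constant.
        κ : V → V → Bool × Bool × Bool
        κ v w = adj (g v) (g w) , adj (g c₁) (g v) , adj (g c₂) (g v)

        open Canonical (finite-× finite-Bool (finite-× finite-Bool finite-Bool)) κ c₁≢c₂

        module _ {k : Table (Bool × Bool × Bool)} (canonical-k : ∀ m → CanonicalUpTo m k) where

          between : Type → Type → Bool → Bool
          between σ τ b = proj₁ (read k σ τ b)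

          -- By convention these values are read at an adjacent second vertex of type
          -- `(true , true)`; `realization` appends such a vertex to every tuple.
          constants : Type → Bool × Bool
          constants τ = proj₂ (read k τ (true , true) true)

          Vertex : Type → V → Set
          Vertex τ v = HasType c₁ c₂ τ v × (adj (g c₁) (g v) , adj (g c₂) (g v)) ≡ constants τ

          Edge : (ℕ → Type) → (ℕ → ℕ → Bool) → (ℕ → V) → ℕ → ℕ → Set
          Edge τ B v i j = v i ≢ v j × adj (v i) (v j) ≡ B i j ×
            adj (g (v i)) (g (v j)) ≡ between (τ i) (τ j) (B i j)

          Realizes : ℕ → (ℕ → Type) → (ℕ → ℕ → Bool) → (ℕ → V) → Set
          Realizes m τ B v =
            (∀ {i} → i < m → Vertex (τ i) (v i)) ×
            (∀ {i j} → i < j → j < m → Edge τ B v i j)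

          -- An additional last vertex makes the images of the pairs with the constants visible for all others.
          opaque
            realization : ∀ m τ B → Σ (ℕ → V) (Realizes m τ B)
            realization m τ B with canonical-k (suc m) τ′ B′
              where
              τ′ : ℕ → Type
              τ′ i = if does (em {i < m}) then τ i else (true , true)
              B′ : ℕ → ℕ → Bool
              B′ i j = if does (em {j < m}) then B i j else true
            ... | v , typed , pairs = v , vertex , edges
              where
              vertex : ∀ {i} → i < m → Vertex (τ i) (v i)
              vertex {i} i<m with typed (ℕ.m<n⇒m<1+n i<m) | proj₂ (proj₂ (pairs i<m ℕ.≤-refl))
              ... | ty | last rewrite dec-true (em {i < m}) i<m | dec-false (em {m < m}) (ℕ.<-irrefl refl) =
                ty , cong proj₂ last
              edges : ∀ {i j} → i < j → j < m → Edge τ B v i j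
              edges {i} {j} i<j j<m with pairs i<j (ℕ.m<n⇒m<1+n j<m)
              ... | edge rewrite dec-true (em {i < m}) (ℕ.<-trans i<j j<m) | dec-true (em {j < m}) j<m =
                proj₁ edge , proj₁ (proj₂ edge) , cong proj₁ (proj₂ (proj₂ edge))

          opaque
            -- Makes a constructed tuple act inside `M`: an automorphism `α` takes the values of `p`
            -- to `u`, so `g ∘ α ∘ p` takes the values of `g` on `u`.
            transport : ∀ {p} → M p → ∀ N (u : ℕ → V) →
              (∀ {i j} → i < N → j < N → i ≢ j → u i ≢ u j × adj (u i) (u j) ≡ adj (p i) (p j)) →
              Σ (V → V) λ p′ → M p′ × (∀ {i} → i < N → p′ i ≡ g (u i))
            transport {p} Mp N u like
              with move N p u (λ i<j j<N → let ne , eq = like (ℕ.<-trans i<j j<N) j<N (ℕ.<⇒≢ i<j) in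
                     (λ same → ℕ.<⇒≢ i<j (injective rigid Mp same)) , ne , sym eq)
            ... | α , Mα , moves = g ∘ α ∘ p , M-∘ Mg (M-∘ Mα Mp) , λ i<N → cong g (moves i<N)

          diagonal-attains : ∀ {τ} (B : V → V → Bool) → (∀ x y → between τ τ (adj x y) ≡ B x y) → Attains B
          diagonal-attains {τ} B agrees N with realization N (λ _ → τ) adj
          ... | v , _ , edges with transport M-id N v (unordered _
                  (λ {i} {j} (ne , eq) → (ne ∘ sym) , trans (adj-sym (v j) (v i)) (trans eq (adj-sym i j)))
                  (λ i<j j<N → let ne , eq , _ = edges i<j j<N in ne , eq))
          ... | p , Mp , images = p , Mp , λ {i} {j} i<j j<N →
            trans (cong₂ adj (images (ℕ.<-trans i<j j<N)) (images j<N))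
              (trans (proj₂ (proj₂ (edges i<j j<N))) (agrees i j))

          diagonal-identical : ∀ τ → Identical (between τ τ)
          diagonal-identical τ with boolean-function (between τ τ)
          ... | inj₁ identical               = identical
          ... | inj₂ (inj₁ negates)          =
            contradiction (diagonal-attains {τ} (λ x y → not (adj x y)) (λ x y → negates (adj x y))) no-negation
          ... | inj₂ (inj₂ (c , constant-f)) =
            contradiction (diagonal-attains {τ} (λ _ _ → c) (λ x y → constant-f (adj x y))) (no-constant c)

          Preserved : (V → V) → (ℕ → V) → ℕ → ℕ → Set
          Preserved p u i j = u i ≢ u j × adj (u i) (u j) ≡ adj (p i) (p j) ×
            adj (g (u i)) (g (u j)) ≡ adj (p i) (p j)

          preserved-sym : ∀ p u {i j} → Preserved p u i j → Preserved p u j i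
          preserved-sym p u {i} {j} (ne , eq , eq′) = ne ∘ sym
            , trans (adj-sym (u j) (u i)) (trans eq (adj-sym (p i) (p j)))
            , trans (adj-sym (g (u j)) (g (u i))) (trans eq′ (adj-sym (p i) (p j)))

          Spoke : (Bool → Bool) → (V → V) → ℕ → V → V → ℕ → Set
          Spoke f p x c v j = c ≢ v × adj c v ≡ adj (p x) (p j) × adj (g c) (g v) ≡ f (adj (p x) (p j))

          -- Replacing `v x` by the centre `c` gives a tuple with the adjacencies of `p`; on it `g`
          -- acts by `f` at the centre and preserves the other pairs.
          star-operation : ∀ f →
            (∀ {p} → M p → ∀ N x → Σ V λ c → Σ (ℕ → V) λ v →
              (∀ {j} → j < N → Spoke f p x c (v j) j) ×
              (∀ {i j} → i < j → j < N → Preserved p v i j)) →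
            StarOperation f
          star-operation f stars {p} Mp N {x} x<N with stars Mp N x
          ... | c , v , centre , rest with transport Mp N u like
            where
            u : ℕ → V
            u i = if does (em {i ≡ x}) then c else v i
            like : ∀ {i j} → i < N → j < N → i ≢ j → u i ≢ u j × adj (u i) (u j) ≡ adj (p i) (p j)
            like {i} {j} i<N j<N i≢j with em {i ≡ x} | em {j ≡ x}
            ... | yes refl | yes refl = contradiction refl i≢j
            ... | yes refl | no _     = let ne , eq , _ = centre j<N in ne , eq
            ... | no _     | yes refl = let ne , eq , _ = centre i<N in
                    ne ∘ sym , trans (adj-sym (v i) c) (trans eq (adj-sym (p j) (p i)))
            ... | no _     | no _     =
                    let ne , eq , _ = unordered (Preserved p v) (preserved-sym p v) rest i<N j<N i≢j in ne , eq
          ... | p′ , Mp′ , images = p′ , Mp′ , star , others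
            where
            image-centre : p′ x ≡ g c
            image-centre =
              trans (images x<N) (cong (λ d → g (if d then c else v x)) (dec-true (em {x ≡ x}) refl))
            image-other : ∀ {i} → i < N → i ≢ x → p′ i ≡ g (v i)
            image-other {i} i<N i≢x =
              trans (images i<N) (cong (λ d → g (if d then c else v i)) (dec-false (em {i ≡ x}) i≢x))
            star : ∀ {j} → j < N → j ≢ x → adj (p′ x) (p′ j) ≡ f (adj (p x) (p j))
            star j<N j≢x = trans (cong₂ adj image-centre (image-other j<N j≢x)) (proj₂ (proj₂ (centre j<N)))
            others : ∀ {i j} → i < N → j < N → i ≢ j → i ≢ x → j ≢ x → adj (p′ i) (p′ j) ≡ adj (p i) (p j)
            others i<N j<N i≢j i≢x j≢x = trans (cong₂ adj (image-other i<N i≢x) (image-other j<N j≢x))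
              (proj₂ (proj₂ (unordered (Preserved p v) (preserved-sym p v) rest i<N j<N i≢j)))

          -- The centre has type `σ` and comes first, since `between σ τ` describes pairs in this
          -- order. The others all have type `τ`, so the pairs among them are preserved by
          -- `diagonal-identical`.
          between-star : ∀ σ τ → StarOperation (between σ τ)
          between-star σ τ = star-operation (between σ τ) λ {p} Mp N x → construct p N x
            where
            τ′ : ℕ → Type
            τ′ zero    = σ
            τ′ (suc _) = τ
            B′ : (V → V) → ℕ → ℕ → ℕ → Bool
            B′ p x zero    (suc j) = adj (p x) (p j)
            B′ p x (suc i) (suc j) = adj (p i) (p j)
            B′ p x _       zero    = false
            construct : ∀ p N x → Σ V λ c → Σ (ℕ → V) λ v →
              (∀ {j} → j < N → Spoke (between σ τ) p x c (v j) j) ×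
              (∀ {i j} → i < j → j < N → Preserved p v i j)
            construct p N x with realization (suc N) τ′ (B′ p x)
            ... | v , _ , edges = v 0 , v ∘ suc , (λ j<N → edges z<s (s<s j<N))
              , λ i<j j<N → let ne , eq , eq′ = edges (s<s i<j) (s<s j<N) in
                ne , eq , trans eq′ (diagonal-identical τ _)

          between-identical : ∀ σ τ → Identical (between σ τ)
          between-identical σ τ = star-identical (between-star σ τ)

          realization-preserved : ∀ p N τ → Σ (ℕ → V) λ v →
            (∀ {i} → i < N → Vertex (τ i) (v i)) ×
            (∀ {i j} → i < j → j < N → Preserved p v i j)
          realization-preserved p N τ with realization N τ (λ i j → adj (p i) (p j))
          ... | v , vertex , edges = v , vertex , λ {i} {j} i<j j<N → let ne , eq , eq′ = edges i<j j<N in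
            ne , eq , trans eq′ (between-identical (τ i) (τ j) (adj (p i) (p j)))

          -- Here `c₁` itself is the centre: the first coordinate of the type of a vertex prescribes
          -- its adjacency to `c₁`, while the second is kept at `b`.
          constant₁-identical : ∀ b → Identical (λ a → proj₁ (constants (a , b)))
          constant₁-identical b =
            star-identical (star-operation (λ a → proj₁ (constants (a , b))) λ {p} Mp N x → construct p N x)
            where
            construct : ∀ p N x → Σ V λ c → Σ (ℕ → V) λ v →
              (∀ {j} → j < N → Spoke (λ a → proj₁ (constants (a , b))) p x c (v j) j) ×
              (∀ {i j} → i < j → j < N → Preserved p v i j)
            construct p N x with realization-preserved p N (λ j → adj (p x) (p j) , b)
            ... | v , vertex , edges = c₁ , v , (λ j<N → let (ne , _ , eq , _) , eq′ = vertex j<N in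
              ne ∘ sym , trans (adj-sym c₁ (v _)) eq , cong proj₁ eq′) , edges

          constant₂-identical : ∀ a → Identical (λ b → proj₂ (constants (a , b)))
          constant₂-identical a =
            star-identical (star-operation (λ b → proj₂ (constants (a , b))) λ {p} Mp N x → construct p N x)
            where
            construct : ∀ p N x → Σ V λ c → Σ (ℕ → V) λ v →
              (∀ {j} → j < N → Spoke (λ b → proj₂ (constants (a , b))) p x c (v j) j) ×
              (∀ {i j} → i < j → j < N → Preserved p v i j)
            construct p N x with realization-preserved p N (λ j → a , adj (p x) (p j))
            ... | v , vertex , edges = c₂ , v , (λ j<N → let (_ , ne , _ , eq) , eq′ = vertex j<N in
              ne ∘ sym , trans (adj-sym c₂ (v _)) eq , cong proj₂ eq′) , edges

          -- The constants take the places of `x` and `y`, and the other vertices get their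
          -- adjacencies to `p x` and `p y` as types; only the pair of constants can change. The
          -- disjunction allows iteration, as a pair already at the target value keeps it.
          flip : ∀ {p} → M p → ∀ N {x y} → x < N → y < N → x ≢ y → adj (p x) (p y) ≡ adj c₁ c₂ →
            Σ (V → V) λ p′ → M p′ × adj (p′ x) (p′ y) ≡ adj (g c₁) (g c₂) ×
            (∀ {i j} → i < N → j < N → i ≢ j →
              adj (p′ i) (p′ j) ≡ adj (p i) (p j) ⊎ adj (p′ i) (p′ j) ≡ adj (g c₁) (g c₂))
          flip {p} Mp N {x} {y} x<N y<N x≢y pair-xy
            with realization-preserved p N (λ j → adj (p x) (p j) , adj (p y) (p j))
          ... | v , vertex , edges =
            result (transport Mp N u (λ i<N j<N i≢j → let ne , eq , _ = like i<N j<N i≢j in ne , eq))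
            where
            u : ℕ → V
            u i = if does (em {i ≡ x}) then c₁ else (if does (em {i ≡ y}) then c₂ else v i)
            u-x : u x ≡ c₁
            u-x rewrite dec-true (em {x ≡ x}) refl = refl
            u-y : u y ≡ c₂
            u-y rewrite dec-false (em {y ≡ x}) (x≢y ∘ sym) | dec-true (em {y ≡ y}) refl = refl
            Flipped : V → V → ℕ → ℕ → Set
            Flipped s t i j = s ≢ t × adj s t ≡ adj (p i) (p j) ×
              (adj (g s) (g t) ≡ adj (p i) (p j) ⊎ adj (g s) (g t) ≡ adj (g c₁) (g c₂))
            flipped-sym : ∀ {s t i j} → Flipped s t i j → Flipped t s j i
            flipped-sym {s} {t} {i} {j} (ne , eq , eq′) =
              ne ∘ sym , trans (adj-sym t s) (trans eq (adj-sym (p i) (p j))) , turn eq′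
              where
              turn : adj (g s) (g t) ≡ adj (p i) (p j) ⊎ adj (g s) (g t) ≡ adj (g c₁) (g c₂) →
                adj (g t) (g s) ≡ adj (p j) (p i) ⊎ adj (g t) (g s) ≡ adj (g c₁) (g c₂)
              turn (inj₁ e) = inj₁ (trans (adj-sym (g t) (g s)) (trans e (adj-sym (p i) (p j))))
              turn (inj₂ e) = inj₂ (trans (adj-sym (g t) (g s)) e)
            constants-flipped : Flipped c₁ c₂ x y
            constants-flipped = c₁≢c₂ , sym pair-xy , inj₂ refl
            at-x : ∀ {j} → j < N → Flipped c₁ (v j) x j
            at-x {j} j<N = let (ne , _ , eq , _) , eq′ = vertex j<N in
              ne ∘ sym , trans (adj-sym c₁ (v _)) eq ,
              inj₁ (trans (cong proj₁ eq′) (constant₁-identical (adj (p y) (p j)) (adj (p x) (p j))))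
            at-y : ∀ {j} → j < N → Flipped c₂ (v j) y j
            at-y {j} j<N = let (_ , ne , _ , eq) , eq′ = vertex j<N in
              ne ∘ sym , trans (adj-sym c₂ (v _)) eq ,
              inj₁ (trans (cong proj₂ eq′) (constant₂-identical (adj (p x) (p j)) (adj (p y) (p j))))
            like : ∀ {i j} → i < N → j < N → i ≢ j → Flipped (u i) (u j) i j
            like {i} {j} i<N j<N i≢j with em {i ≡ x} | em {i ≡ y} | em {j ≡ x} | em {j ≡ y}
            ... | yes refl | _        | yes refl | _        = contradiction refl i≢j
            ... | yes refl | _        | no _     | yes refl = constants-flipped
            ... | yes refl | _        | no _     | no _     = at-x j<N
            ... | no _     | yes refl | yes refl | _        = flipped-sym constants-flipped
            ... | no _     | yes refl | no _     | yes refl = contradiction refl i≢j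
            ... | no _     | yes refl | no _     | no _     = at-y j<N
            ... | no _     | no _     | yes refl | _        = flipped-sym (at-x i<N)
            ... | no _     | no _     | no _     | yes refl = flipped-sym (at-y i<N)
            ... | no _     | no _     | no _     | no _     =
              let ne , eq , eq′ = unordered (Preserved p v) (preserved-sym p v) edges i<N j<N i≢j in ne , eq , inj₁ eq′
            result : (Σ (V → V) λ p′ → M p′ × (∀ {i} → i < N → p′ i ≡ g (u i))) →
              Σ (V → V) λ p′ → M p′ × adj (p′ x) (p′ y) ≡ adj (g c₁) (g c₂) ×
              (∀ {i j} → i < N → j < N → i ≢ j →
                adj (p′ i) (p′ j) ≡ adj (p i) (p j) ⊎ adj (p′ i) (p′ j) ≡ adj (g c₁) (g c₂))
            result (p′ , Mp′ , images) = p′ , Mp′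
              , cong₂ adj (trans (images x<N) (cong g u-x)) (trans (images y<N) (cong g u-y)) , others
              where
              others : ∀ {i j} → i < N → j < N → i ≢ j →
                adj (p′ i) (p′ j) ≡ adj (p i) (p j) ⊎ adj (p′ i) (p′ j) ≡ adj (g c₁) (g c₂)
              others i<N j<N i≢j rewrite images i<N | images j<N = proj₂ (proj₂ (like i<N j<N i≢j))

          -- Otherwise, flipping in turn every pair that still has the adjacency of `c₁` and `c₂`
          -- would make every initial segment homogeneous.
          preserves-adjacency : adj (g c₁) (g c₂) ≡ adj c₁ c₂
          preserves-adjacency = decidable-stable (_ Bool.≟ _) λ flips →
            no-constant (adj (g c₁) (g c₂)) (all-flipped flips)
            where
            all-flipped : adj (g c₁) (g c₂) ≢ adj c₁ c₂ → Attains (λ _ _ → adj (g c₁) (g c₂))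
            all-flipped flips N = let p , Mp , done = iterate Done step (cartesianProduct (upTo N) (upTo N)) in
              p , Mp , λ i<j j<N → let i<N = ℕ.<-trans i<j j<N in
                done (∈-cartesianProduct⁺ (∈-upTo⁺ i<N) (∈-upTo⁺ j<N)) i<N j<N (ℕ.<⇒≢ i<j)
              where
              Done : ℕ × ℕ → (V → V) → Set
              Done (x , y) p = x < N → y < N → x ≢ y → adj (p x) (p y) ≡ adj (g c₁) (g c₂)
              step : ∀ t {p} → M p → Σ (V → V) λ p′ → M p′ × Done t p′ × (∀ {t′} → Done t′ p → Done t′ p′)
              step (x , y) {p} Mp with em {x < N × y < N × x ≢ y} | adj (p x) (p y) Bool.≟ adj c₁ c₂
              ... | no out | _ = p , Mp , (λ x<N y<N x≢y → contradiction (x<N , y<N , x≢y) out) , id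
              -- There being only two values, a pair that differs from `adj c₁ c₂` has the target
              -- value already.
              ... | yes _ | no flipped = p , Mp , (λ _ _ _ → trans (¬-not flipped) (sym (¬-not flips))) , id
              ... | yes (x<N , y<N , x≢y) | yes unflipped with flip Mp N x<N y<N x≢y unflipped
              ...   | p′ , Mp′ , now , others = p′ , Mp′ , (λ _ _ _ → now) , keep
                where
                keep : ∀ {t} → Done t p → Done t p′
                keep done i<N j<N i≢j with others i<N j<N i≢j
                ... | inj₁ same    = trans same (done i<N j<N i≢j)
                ... | inj₂ flipped = flipped

        adjacency-preserved : adj (g c₁) (g c₂) ≡ adj c₁ c₂
        adjacency-preserved = preserves-adjacency (proj₂ canonical)

-- Reducts of the random graph

-- Valuations are related pointwise, which avoids function extensionality under quantifiers;
-- surjectivity of `α` supplies preimages for the quantified vertices.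
Sat-invariant : ∀ {E α} → IsGraphAut E α → ∀ {n} (φ : Formula n) {ρ σ : Fin n → V} →
  (∀ i → σ i ≡ α (ρ i)) → Sat E φ ρ ⇔ Sat E φ σ
Sat-invariant {E} {α} ((inj , surj) , iso) = go
  where
  extended : ∀ {n} {ρ σ : Fin n → V} {v w} → w ≡ α v → (∀ i → σ i ≡ α (ρ i)) →
    ∀ i → extend w σ i ≡ α (extend v ρ i)
  extended eq eqs zero    = eq
  extended eq eqs (suc i) = eqs i
  go : ∀ {n} (φ : Formula n) {ρ σ : Fin n → V} → (∀ i → σ i ≡ α (ρ i)) → Sat E φ ρ ⇔ Sat E φ σ
  go (Formula.eq i j) eqs = mk⇔
    (λ same → trans (eqs i) (trans (cong α same) (sym (eqs j))))
    (λ same → inj (trans (sym (eqs i)) (trans same (eqs j))))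
  go (Formula.edge i j) {ρ} eqs rewrite eqs i | eqs j = iso (ρ i) (ρ j)
  go (Formula.neg φ) eqs = mk⇔ (_∘ from (go φ eqs)) (_∘ to (go φ eqs))
  go (Formula.and φ ψ) eqs = mk⇔
    (λ (p , q) → to (go φ eqs) p , to (go ψ eqs) q) (λ (p , q) → from (go φ eqs) p , from (go ψ eqs) q)
  go (Formula.or φ ψ) eqs = mk⇔
    [ inj₁ ∘ to (go φ eqs) , inj₂ ∘ to (go ψ eqs) ] [ inj₁ ∘ from (go φ eqs) , inj₂ ∘ from (go ψ eqs) ]
  go (Formula.ex φ) eqs = mk⇔
    (λ (v , p) → α v , to (go φ (extended refl eqs)) p)
    (λ (w , p) → proj₁ (surj w) , from (go φ (extended (sym (proj₂ (surj w) refl)) eqs)) p)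
  go (Formula.all φ) eqs = mk⇔
    (λ p w → to (go φ (extended (sym (proj₂ (surj w) refl)) eqs)) (p (proj₁ (surj w))))
    (λ p v → from (go φ (extended refl eqs)) (p (α v)))

tuple-bound : ∀ {n} (t : Fin n → ℕ) → ∃ λ N → ∀ i → t i < N
tuple-bound {zero}  t = 0 , λ ()
tuple-bound {suc n} t with tuple-bound (t ∘ suc)
... | N , bounded = suc (t zero) ⊔ N , λ
  { zero → ℕ.m≤m⊔n (suc (t zero)) N ; (suc i) → ℕ.<-≤-trans (bounded i) (ℕ.m≤n⊔m (suc (t zero)) N) }

list-bound : (xs : List ℕ) → ∃ λ N → All (_< N) xs
list-bound []       = 0 , []
list-bound (x ∷ xs) with list-bound xs
... | N , bounded = suc x ⊔ N , ℕ.m≤m⊔n (suc x) N ∷ All.map (λ x<N → ℕ.<-≤-trans x<N (ℕ.m≤n⊔m (suc x) N)) bounded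

Switch-incident : ∀ {E s t} → s ≢ t → s ≡ 0 ⊎ t ≡ 0 → Switch E s t ⇔ (¬ E s t)
Switch-incident {s = s} {t} s≢t incident with s ℕ.≟ 0 | t ℕ.≟ 0
... | yes refl | yes refl = contradiction refl s≢t
... | yes _    | no _     = ⇔-id _
... | no _     | yes _    = ⇔-id _
... | no s≢0   | no t≢0   = contradiction incident [ s≢0 , t≢0 ]

Switch-other : ∀ {E s t} → ¬ (s ≡ 0 ⊎ t ≡ 0) → Switch E s t ⇔ E s t
Switch-other {s = s} {t} other with s ℕ.≟ 0 | t ℕ.≟ 0
... | yes s≡0 | _       = contradiction (inj₁ s≡0) other
... | no _    | yes t≡0 = contradiction (inj₂ t≡0) other
... | no _    | no _    = ⇔-id _

module Endomorphisms (em : ExcludedMiddle 0ℓ) {E : Rel₂} (random : IsRandomGraph E)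
                     (Γ : Structure) (definable : FODefinable E Γ) where
  open RandomGraph em random

  rel-invariant : ∀ {α} → IsGraphAut E α → ∀ i {t s : Fin (arity Γ i) → V} →
    (∀ x → s x ≡ α (t x)) → rel Γ i t ⇔ rel Γ i s
  rel-invariant aut i {t} {s} eqs = let φ , defines = definable i in mk⇔
    (from (defines s) ∘ to (Sat-invariant aut φ eqs) ∘ to (defines t))
    (from (defines t) ∘ from (Sat-invariant aut φ eqs) ∘ to (defines s))

  endo-∘ : ∀ f g → IsEndo Γ f → IsEndo Γ g → IsEndo Γ (f ∘ g)
  endo-∘ f g endo-f endo-g i t = endo-f i (g ∘ t) ∘ endo-g i t

  aut-endo : ∀ {α} → IsGraphAut E α → IsEndo Γ α
  aut-endo aut i t = to (rel-invariant aut i (λ _ → refl))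

  endo-closed : ∀ f → (∀ N → Σ (V → V) λ g → IsEndo Γ g × (∀ {i} → i < N → g i ≡ f i)) → IsEndo Γ f
  endo-closed f approx i t r with tuple-bound t
  ... | N , bounded with approx N
  -- Invariance under `id` allows pointwise equal tuples to be exchanged.
  ...   | g , endo-g , agree = to (rel-invariant id-aut i (λ x → sym (agree (bounded x)))) (endo-g i t r)

  open Monoid em random (IsEndo Γ) endo-∘ aut-endo endo-closed

  adj-same : ∀ {x y s t} → E x y ⇔ E s t → adj s t ≡ adj x y
  adj-same {x} {y} equiv with em {E x y}
  ... | yes e = E⇒adj (to equiv e)
  ... | no ¬e = ¬E⇒adj (¬e ∘ from equiv)

  adj-opposite : ∀ {x y s t} → E x y ⇔ (¬ E s t) → adj s t ≡ not (adj x y)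
  adj-opposite {x} {y} {s} {t} equiv with em {E x y} | em {E s t}
  ... | yes e | yes e′ = contradiction e′ (to equiv e)
  ... | yes e | no _   = refl
  ... | no _  | yes _  = refl
  ... | no ¬e | no ¬e′ = contradiction (from equiv ¬e′) ¬e

  graph-aut : ∀ {f} → Bijective _≡_ _≡_ f → (∀ {x y} → x ≢ y → adj (f x) (f y) ≡ adj x y) → IsGraphAut E f
  graph-aut {f} bij preserves = bij , λ x y → mk⇔
    (λ e → adj⇒E (trans (adj-preserved f preserves x y) (E⇒adj e)))
    (λ e → adj⇒E (trans (sym (adj-preserved f preserves x y)) (E⇒adj e)))

  -- To reflect a relation, `F ∘ α` is applied to the image tuple; the result is the original tuple
  -- moved by an automorphism of the graph.
  automorphism : ∀ {F α} → Bijective _≡_ _≡_ F → IsEndo Γ F → IsGraphAut E α →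
    IsGraphAut E (F ∘ α ∘ F) → IsAuto Γ F
  automorphism bij endo-F aut-α aut = bij , λ i t → mk⇔ (endo-F i t)
    (from (rel-invariant aut i (λ _ → refl)) ∘ endo-F i _ ∘ aut-endo aut-α i _)

  module _ {minus : V → V} (iso : IsIso E (Compl E) minus) where

    minus-adj : ∀ {x y} → x ≢ y → adj (minus x) (minus y) ≡ not (adj x y)
    minus-adj {x} {y} x≢y = adj-opposite (mk⇔ proj₂ (λ ¬e → x≢y ∘ proj₁ (proj₁ iso) , ¬e) ⇔-∘ proj₂ iso x y)

    minus-auto : IsEndo Γ minus → IsAuto Γ minus
    minus-auto endo = automorphism (proj₁ iso) endo id-aut
      (graph-aut (Composition.bijective _≡_ _≡_ _≡_ (proj₁ iso) (proj₁ iso)) λ x≢y →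
        trans (minus-adj (x≢y ∘ proj₁ (proj₁ iso))) (trans (cong not (minus-adj x≢y)) (not-involutive _)))

  module _ {sw : V → V} (iso : IsIso E (Switch E) sw) where

    private
      sw-injective : Injective _≡_ _≡_ sw
      sw-injective = proj₁ (proj₁ iso)

    -- `Switch` refers to 0 in the target, so the star changed by `sw` is that of the preimage of 0.
    centre : V
    centre = proj₁ (proj₂ (proj₁ iso) 0)

    sw-centre : sw centre ≡ 0
    sw-centre = proj₂ (proj₂ (proj₁ iso) 0) refl

    Incident : V → V → Set
    Incident x y = x ≡ centre ⊎ y ≡ centre

    sw-incident : ∀ {x y} → x ≢ y → Incident x y → adj (sw x) (sw y) ≡ not (adj x y)
    sw-incident {x} {y} x≢y incident = adj-opposite
      (Switch-incident (x≢y ∘ sw-injective)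
        ([ (λ { refl → inj₁ sw-centre }) , (λ { refl → inj₂ sw-centre }) ] incident)
      ⇔-∘ proj₂ iso x y)

    sw-other : ∀ {x y} → ¬ Incident x y → adj (sw x) (sw y) ≡ adj x y
    sw-other {x} {y} other = adj-same
      (Switch-other
        [ (λ eq → other (inj₁ (sw-injective (trans eq (sym sw-centre)))))
        , (λ eq → other (inj₂ (sw-injective (trans eq (sym sw-centre))))) ]
      ⇔-∘ proj₂ iso x y)

    sw-adj : ∀ {x y} → x ≢ y → adj (sw x) (sw y) ≡ (if does (em {Incident x y}) then not (adj x y) else adj x y)
    sw-adj {x} {y} x≢y with em {Incident x y}
    ... | yes incident = sw-incident x≢y incident
    ... | no other     = sw-other other

    -- With α moving 0 to the centre, both applications of sw in sw ∘ α ∘ sw switch the same vertex.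
    sw-auto : IsEndo Γ sw → IsAuto Γ sw
    sw-auto endo with homogeneity 1 (const 0) (const centre) (λ _ _ →
      (λ _ → refl) , (λ _ → refl) , trans (adj-irrefl 0) (sym (adj-irrefl centre)))
    ... | α , aut@((α-inj , α-surj) , α-iso) , moves =
      automorphism (proj₁ iso) endo aut (graph-aut bijective preserved)
      where
      bijective : Bijective _≡_ _≡_ (sw ∘ α ∘ sw)
      bijective = Composition.bijective _≡_ _≡_ _≡_
        (Composition.bijective _≡_ _≡_ _≡_ (proj₁ iso) (proj₁ aut)) (proj₁ iso)
      β : V → V
      β = α ∘ sw
      β-adj : ∀ x y → adj (β x) (β y) ≡ adj (sw x) (sw y)
      β-adj x y = adj-same (α-iso (sw x) (sw y))
      β-injective : Injective _≡_ _≡_ β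
      β-injective = sw-injective ∘ α-inj
      β-centre : β centre ≡ centre
      β-centre = trans (cong α sw-centre) (moves {0} z<s)
      preserved : ∀ {x y} → x ≢ y → adj (sw (β x)) (sw (β y)) ≡ adj x y
      preserved {x} {y} x≢y with em {Incident x y}
      ... | yes incident = trans (sw-incident (x≢y ∘ β-injective)
              ([ (λ { refl → inj₁ β-centre }) , (λ { refl → inj₂ β-centre }) ] incident))
            (trans (cong not (trans (β-adj x y) (sw-incident x≢y incident))) (not-involutive _))
      ... | no other = trans (sw-other
              [ (λ eq → other (inj₁ (β-injective (trans eq (sym β-centre)))))
              , (λ eq → other (inj₂ (β-injective (trans eq (sym β-centre))))) ])
            (trans (β-adj x y) (sw-other other))

  embedding-generated : ∀ {f} → Injective _≡_ _≡_ f → (∀ {x y} → x ≢ y → adj (f x) (f y) ≡ adj x y) →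
    InGeneratedLCMonoid (IsGraphAut E) f
  embedding-generated {f} f-inj preserves M′ _ closed contains = closed f λ xs →
    let N , bounded = list-bound xs
        α , aut , moves = homogeneity N id f (λ {i} {j} _ _ → cong f , f-inj , sym (adj-preserved f preserves i j))
    in α , contains α aut , All.map moves bounded

  classification : ∀ {eE eN minus sw} → IsEE E eE → IsEN E eN → IsIso E (Compl E) minus → IsIso E (Switch E) sw →
    (Σ V λ c → IsEndo Γ (const c))
    ⊎ (IsEndo Γ eE
    ⊎ (IsEndo Γ eN
    ⊎ (IsAuto Γ minus
    ⊎ (IsAuto Γ sw
    ⊎ ((f : V → V) → IsEndo Γ f → InGeneratedLCMonoid (IsGraphAut E) f)))))
  classification {eE} {eN} {minus} {sw} (eE-inj , clique) (eN-inj , independent) iso-minus iso-sw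
    with em {Collapses true} | em {Collapses false}
  ... | yes collapse-E | yes collapse-N = inj₁ (0 , constant λ { true → collapse-E ; false → collapse-N })
  ... | yes collapse-E | no rigid-N = inj₂ (inj₂ (inj₁ (approximable eN-inj λ N →
          let h , endo , independent-h = Half.monochromatic true collapse-E rigid-N N in h , endo , λ i<j j<N →
            let ne , eq = independent-h i<j j<N in ne , trans eq (sym (¬E⇒adj (independent _ _))))))
  ... | no rigid-E | yes collapse-N = inj₂ (inj₁ (approximable eE-inj λ N →
          let h , endo , clique-h = Half.monochromatic false collapse-N rigid-E N in h , endo , λ i<j j<N →
            let ne , eq = clique-h i<j j<N in ne , trans eq (sym (E⇒adj (clique _ _ (ℕ.<⇒≢ i<j))))))
  ... | no rigid-E | no rigid-N
    with em {IsEndo Γ eE} | em {IsEndo Γ eN} | em {IsEndo Γ minus} | em {IsEndo Γ sw}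
  ...   | yes endo | _ | _ | _ = inj₂ (inj₁ endo)
  ...   | no _ | yes endo | _ | _ = inj₂ (inj₂ (inj₁ endo))
  ...   | no _ | no _ | yes endo | _ = inj₂ (inj₂ (inj₂ (inj₁ (minus-auto iso-minus endo))))
  ...   | no _ | no _ | no _ | yes endo = inj₂ (inj₂ (inj₂ (inj₂ (inj₁ (sw-auto iso-sw endo)))))
  ...   | no ¬eE | no ¬eN | no ¬minus | no ¬sw = inj₂ (inj₂ (inj₂ (inj₂ (inj₂ λ f endo →
            embedding-generated (injective rigid endo)
              (adjacency-preserved no-constant no-negation (centre iso-sw , no-switch) endo)))))
    where
    rigid : ∀ b → ¬ Collapses b
    rigid true  = rigid-E
    rigid false = rigid-N
    open Rigid rigid
    attains-if : ∀ {F B} → Injective _≡_ _≡_ F →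
      (∀ {i j} → i ≢ j → adj (F i) (F j) ≡ B i j) → Attains B → IsEndo Γ F
    attains-if F-inj agrees attain = attains F-inj λ N → let h , endo , pattern′ = attain N in
      h , endo , λ i<j j<N → trans (pattern′ i<j j<N) (sym (agrees (ℕ.<⇒≢ i<j)))
    no-constant : ∀ c → ¬ Attains (λ _ _ → c)
    no-constant true  = ¬eE ∘ attains-if eE-inj (λ i≢j → E⇒adj (clique _ _ i≢j))
    no-constant false = ¬eN ∘ attains-if eN-inj (λ _ → ¬E⇒adj (independent _ _))
    no-negation : ¬ Attains (λ x y → not (adj x y))
    no-negation = ¬minus ∘ attains-if (proj₁ (proj₁ iso-minus)) (minus-adj iso-minus)
    no-switch : ¬ Attains (switched (centre iso-sw))
    no-switch = ¬sw ∘ attains-if (proj₁ (proj₁ iso-sw)) (sw-adj iso-sw)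

theorem7 : ExcludedMiddle 0ℓ →
    (E : Rel₂) → IsRandomGraph E →
    (eE eN minus sw : V → V) →
    IsEE E eE → IsEN E eN → IsIso E (Compl E) minus → IsIso E (Switch E) sw →
    (Γ : Structure) → FODefinable E Γ →
    (Σ V λ c → IsEndo Γ (const c))
    ⊎ (IsEndo Γ eE
    ⊎ (IsEndo Γ eN
    ⊎ (IsAuto Γ minus
    ⊎ (IsAuto Γ sw
    ⊎ ((f : V → V) → IsEndo Γ f → InGeneratedLCMonoid (IsGraphAut E) f)))))
theorem7 em E random eE eN minus sw isEE isEN iso-minus iso-sw Γ definable =
  Endomorphisms.classification em random Γ definable isEE isEN iso-minus iso-sw
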